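{- Let $m\geq 1$ and $n\geq 2$, and let $p(m,n)$ be the number of Fibonacci polyominoes with horizontal semiperimeter $m$ and vertical semiperimeter $n$. Then \[ p(m,n)=C_m\binom{n-2}{m-1}+C_{m-1}\binom{n-2}{m-2}, \] where $C_k=\frac{1}{k+1}\binom{2k}{k}$ is the $k$th Catalan number. Moreover, the first term $C_m\binom{n-2}{m-1}$ is the number of those polyominoes whose last (rightmost) column has height at least $2$, and the second term $C_{m-1}\binom{n-2}{m-2}$ is the number of those whose last column has height $1$. In particular, $p(n,n)=C_{n-1}$ for every $n\geq 2$.
   Context: A Fibonacci polyomino is a (nonempty) polyomino, considered up to translation, that is column-convex (each column is a contiguous segment of unit cells) and such that, reading columns from left to right, the bottom cell of each column lies exactly one unit above the bottom cell of the preceding column. Equivalently, it is given by a sequence of column heights $(h_1,\dots,h_m)$, $m\ge 1$, with $h_i\ge 2$ for $1\le i\le m-1$ and $h_m\ge 1$; column $i$ consists of the cells in column position $i$ and rows $i,i+1,\dots,i+h_i-1$. The horizontal (resp. vertical) semiperimeter of a polyomino is half the number of horizontal (resp. vertical) unit edges on its boundary (a boundary edge is a unit edge belonging to exactly one cell). A binomial coefficient $\binom{a}{b}$ with $a\ge 0$ is $0$ if $b<0$ or $b>a$. -}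

module Defs where

open import Data.Integer as ℤ using (ℤ; +_; -[1+_]; ∣_∣; 0ℤ; 1ℤ)
import Data.Integer.Properties as ℤ
open import Data.List using (List; []; _∷_; concatMap; filter; length)
open import Data.List.Membership.Propositional using (_∈_)
import Data.List.Membership.DecPropositional as DecMembership
open import Data.List.Relation.Unary.Unique.Propositional using (Unique)
open import Data.Nat as ℕ using (ℕ; suc)
open import Data.Nat.Combinatorics using (_C_)
open import Data.Nat.DivMod using (_/_)
open import Data.Product using (∃; _×_; _,_; proj₁)
open import Data.Product.Properties using (≡-dec)
open import Function using (_⇔_; mk⇔; Equivalence; Inverse)
open import Level using (0ℓ)
open import Relation.Binary using (Setoid; IsEquivalence; DecidableEquality)
open import Relation.Binary.Construct.Closure.ReflexiveTransitive using (Star)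
import Relation.Binary.Construct.On as On
open import Relation.Binary.PropositionalEquality using (_≡_; _≢_; refl; sym; trans; cong; cong₂; subst; setoid)
open import Data.Fin using (Fin)

-- The cell (x , y) is the unit square [x , x + 1] × [y , y + 1]:
-- x is its column and y its row.
Cell : Set
Cell = ℤ × ℤ

Adjacent : Cell → Cell → Set
Adjacent (x , y) (x′ , y′) = ∣ x ℤ.- x′ ∣ ℕ.+ ∣ y ℤ.- y′ ∣ ≡ 1

-- The order of the list is immaterial: see _≈_ below.
record Polyomino : Set where
  field
    cells     : List Cell
    unique    : Unique cells
    nonempty  : cells ≢ []
    connected : ∀ {c d} → c ∈ cells → d ∈ cells →
                Star (λ a b → a ∈ cells × b ∈ cells × Adjacent a b) c d

open Polyomino public

translate : ℤ × ℤ → Cell → Cell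
translate (u , v) (x , y) = (x ℤ.+ u , y ℤ.+ v)

infix 4 _≈_

-- Equality of the underlying sets of cells up to translation.
_≈_ : Polyomino → Polyomino → Set
P ≈ Q = ∃ λ v → ∀ c → (c ∈ cells P) ⇔ (translate v c ∈ cells Q)

private
  neg : ℤ × ℤ → ℤ × ℤ
  neg (u , v) = (ℤ.- u , ℤ.- v)

  add : ℤ × ℤ → ℤ × ℤ → ℤ × ℤ
  add (u , v) (u′ , v′) = (u ℤ.+ u′ , v ℤ.+ v′)

  translate-0 : ∀ c → translate (0ℤ , 0ℤ) c ≡ c
  translate-0 (x , y) = cong₂ _,_ (ℤ.+-identityʳ x) (ℤ.+-identityʳ y)

  translate-add : ∀ v w c → translate w (translate v c) ≡ translate (add v w) c
  translate-add (u , v) (u′ , v′) (x , y) =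
    cong₂ _,_ (ℤ.+-assoc x u u′) (ℤ.+-assoc y v v′)

  translate-neg : ∀ v c → translate v (translate (neg v) c) ≡ c
  translate-neg (u , v) (x , y) = cong₂ _,_ (cancel x u) (cancel y v)
    where
    cancel : ∀ i j → i ℤ.+ ℤ.- j ℤ.+ j ≡ i
    cancel i j = trans (ℤ.+-assoc i (ℤ.- j) j)
      (trans (cong (ℤ._+_ i) (ℤ.+-inverseˡ j)) (ℤ.+-identityʳ i))

≈-isEquivalence : IsEquivalence _≈_
≈-isEquivalence = record
  { refl = λ {P} → (0ℤ , 0ℤ) , λ c → mk⇔
      (subst (_∈ cells P) (sym (translate-0 c)))
      (subst (_∈ cells P) (translate-0 c))
  ; sym = λ {P} {Q} (v , f) → neg v , λ c → mk⇔
      (λ c∈Q → Equivalence.from (f (translate (neg v) c))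
                 (subst (_∈ cells Q) (sym (translate-neg v c)) c∈Q))
      (λ c∈P → subst (_∈ cells Q) (translate-neg v c)
                 (Equivalence.to (f (translate (neg v) c)) c∈P))
  ; trans = λ {P} {Q} {R} (v , f) (w , g) → add v w , λ c → mk⇔
      (λ c∈P → subst (_∈ cells R) (translate-add v w c)
                 (Equivalence.to (g (translate v c)) (Equivalence.to (f c) c∈P)))
      (λ c∈R → Equivalence.from (f c) (Equivalence.from (g (translate v c))
                 (subst (_∈ cells R) (sym (translate-add v w c)) c∈R)))
  }

polyominoSetoid : Setoid 0ℓ 0ℓ
polyominoSetoid = record { isEquivalence = ≈-isEquivalence }

ColumnConvex : Polyomino → Set
ColumnConvex P = ∀ {x y₁ y y₂} → (x , y₁) ∈ cells P → (x , y₂) ∈ cells P →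
                 y₁ ℤ.≤ y → y ℤ.≤ y₂ → (x , y) ∈ cells P

IsBottom : Polyomino → Cell → Set
IsBottom P (x , y) = (x , y) ∈ cells P × (∀ y′ → (x , y′) ∈ cells P → y ℤ.≤ y′)

-- By connectedness, the nonempty columns occupy consecutive positions.
BottomsRiseByOne : Polyomino → Set
BottomsRiseByOne P = ∀ {x y y′} → IsBottom P (x , y) → IsBottom P (x ℤ.+ 1ℤ , y′) →
                     y′ ≡ y ℤ.+ 1ℤ

IsFibonacci : Polyomino → Set
IsFibonacci P = ColumnConvex P × BottomsRiseByOne P

-- A horizontal (vertical) unit edge is named by its left (lower) endpoint.
Edge : Set
Edge = ℤ × ℤ

_≟-Edge_ : DecidableEquality Edge
_≟-Edge_ = ≡-dec ℤ._≟_ ℤ._≟_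

open DecMembership _≟-Edge_ using (_∈?_)

horizontalEdges verticalEdges : Cell → List Edge
horizontalEdges (x , y) = (x , y) ∷ (x , y ℤ.+ 1ℤ) ∷ []
verticalEdges   (x , y) = (x , y) ∷ (x ℤ.+ 1ℤ , y) ∷ []

-- Edges belonging to exactly one cell.  Such an edge occurs exactly once in
-- concatMap edges cs, so the result has no repetitions.
boundary : (Cell → List Edge) → List Cell → List Edge
boundary edges cs =
  filter (λ e → length (filter (λ c → e ∈? edges c) cs) ℕ.≟ 1) (concatMap edges cs)

HasHorizontalSemiperimeter HasVerticalSemiperimeter : Polyomino → ℕ → Set
HasHorizontalSemiperimeter P m = length (boundary horizontalEdges (cells P)) ≡ 2 ℕ.* m
HasVerticalSemiperimeter   P n = length (boundary verticalEdges   (cells P)) ≡ 2 ℕ.* n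

columnHeight : Polyomino → ℤ → ℕ
columnHeight P x = length (filter (λ c → proj₁ c ℤ.≟ x) (cells P))

IsLastColumn : Polyomino → ℤ → Set
IsLastColumn P x = (∃ λ y → (x , y) ∈ cells P) × (∀ {c} → c ∈ cells P → proj₁ c ℤ.≤ x)

LastColumnHeight : (ℕ → Set) → Polyomino → Set
LastColumnHeight H P = ∃ λ x → IsLastColumn P x × H (columnHeight P x)

FibonacciOfSize : ℕ → ℕ → Polyomino → Set
FibonacciOfSize m n P =
  IsFibonacci P × HasHorizontalSemiperimeter P m × HasVerticalSemiperimeter P n

-- There are exactly k polyominoes satisfying Q, up to translation.
NumberOf : (Polyomino → Set) → ℕ → Set
NumberOf Q k = Inverse (On.setoid polyominoSetoid (proj₁ {B = Q})) (setoid (Fin k))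

-- The division is exact.
catalan : ℕ → ℕ
catalan k = ((2 ℕ.* k) C k) / suc k

binom : ℕ → ℤ → ℕ
binom a (+ b)    = a C b
binom a -[1+ _ ] = 0

{-# OPTIONS --safe #-}

-- A Fibonacci polyomino is determined by its column heights h₁, …, hₘ, and half of its
-- boundary edges of one direction are those carried by the cells without a lower (resp.
-- left) neighbour.  So m is the number of columns and n = h₁ + ∑ (hᵢ₊₁ + 1 − hᵢ)⁺.
-- Writing hᵢ = kᵢ + 2, a polyomino whose last column has height at least 2 is a sequence
-- k₁, …, kₘ ≥ 0 with k₁ + ∑ (kᵢ₊₁ + 1 − kᵢ)⁺ = n − 2; a last column of height 1 costs
-- nothing, which turns the second count into the first one for m − 1 columns.
--
-- To count the sequences, let W m g be the generating function, in z, of those of length m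
-- that follow the value g, where each increment (1 + k − previous)⁺ is paid.  Then
-- W (m + 1) = T (W m) with (T f) g = ∑_{k < g} f k + ∑_{k ≥ g} z^(k − g + 1) f k.  With
-- q = z / (1 − z), T sends q^r (g choose i) to
--   q^r (g choose i + 1) + q^(r+1) (g choose i) + q^(r+2) (g choose i − 1) + … + q^(r+i+1),
-- which is the Catalan generating tree i ↦ i + 1, i, …, 0.  The last application of T,
-- evaluated at g = 1, turns each q^r (g choose i) with i + r = m − 1 into
-- q^(m−1) (1 + q) = z^(m−1) / (1 − z)^m, whose coefficients are binomial.
module Submission where

open import Data.Empty using (⊥)
open import Data.Fin using (Fin; zero; suc)
open import Data.Fin.Properties using (injective⇒≤)
open import Data.Integer using (_⊖_)
open import Data.List using (List; []; _∷_; _++_; map; length; lookup; filter; concatMap; applyUpTo; upTo)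
open import Data.List.Membership.Propositional using (_∈_; _∉_)
import Data.List.Membership.DecPropositional as DecMembership
open import Data.List.Membership.Propositional.Properties
open import Data.List.Properties using (length-++; length-map; length-upTo; map-injective; ++-cancelʳ; ∷-injectiveʳ; filter-accept; filter-reject; filter-++)
open import Data.List.Relation.Unary.All as All using (All; []; _∷_)
open import Data.List.Relation.Unary.All.Properties using (++⁺)
open import Data.List.Relation.Unary.AllPairs using ([]; _∷_)
open import Data.List.Relation.Unary.Any as Any using (here; there)
open import Data.List.Relation.Unary.Any.Properties using (lookup-index)
open import Data.List.Relation.Unary.Unique.Propositional using (Unique)
import Data.List.Relation.Unary.Unique.Propositional.Properties as Unique
open import Data.Nat using (ℕ; zero; suc; pred; _+_; _*_; _∸_; _≤_; _<_; z≤n; s≤s; _≤?_; >-nonZero)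
open import Data.Nat.Combinatorics using (_C_; nCk+nC[k+1]≡[n+1]C[k+1]; nCk≡nC[n∸k]; nC1≡n; nCn≡1; k>n⇒nCk≡0)
open import Data.Nat.DivMod using (_/_; m*n/n≡m)
open import Data.Nat.ListAction using (sum)
open import Data.Nat.Properties
open import Data.Nat.Tactic.RingSolver using (solve-∀)
open import Data.Product using (∃; _×_; _,_; proj₁; proj₂)
open import Data.Sum using (_⊎_; inj₁; inj₂)
open import Function using (_∘_; _⇔_; mk⇔; Equivalence)
open import Relation.Binary using (IsEquivalence)
open import Relation.Binary.Construct.Closure.ReflexiveTransitive using (Star; ε; _◅_; _◅◅_; reverse)
open import Relation.Binary.PropositionalEquality using (_≡_; _≢_; refl; sym; trans; cong; cong₂; subst; subst₂; module ≡-Reasoning)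
open import Relation.Nullary using (¬_; ¬?; yes; no; contradiction)
open import Relation.Unary using (Decidable)
open import Defs

open DecMembership _≟-Edge_ using (_∈?_)
open Equivalence using (to; from)

-- Sequences of given climb

climb : ℕ → List ℕ → ℕ
climb g []       = 0
climb g (k ∷ ks) = (suc k ∸ g) + climb k ks

mutual
  -- The two halves follow the two sums in T. A next value below `g` is free, so `climbsBelow`
  -- recurses on `g`. A next value `g + d` costs `suc d`, so `climbsAbove` raises `g` while lowering
  -- the budget `N`, which also bounds the recursion.
  climbs : ℕ → ℕ → ℕ → List (List ℕ)
  climbs zero    g zero    = [] ∷ []
  climbs zero    g (suc N) = []
  climbs (suc m) g N       = climbsBelow m g N ++ climbsAbove m g N

  climbsBelow : ℕ → ℕ → ℕ → List (List ℕ)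
  climbsBelow m zero    N = []
  climbsBelow m (suc g) N = map (g ∷_) (climbs m g N) ++ climbsBelow m g N

  climbsAbove : ℕ → ℕ → ℕ → List (List ℕ)
  climbsAbove m g zero    = []
  climbsAbove m g (suc N) = map (g ∷_) (climbs m g N) ++ climbsAbove m (suc g) N

∈-climbsBelow⁻ : ∀ m g N {ks} → ks ∈ climbsBelow m g N →
                 ∃ λ k → ∃ λ ks′ → ks ≡ k ∷ ks′ × k < g × ks′ ∈ climbs m k N
∈-climbsBelow⁻ m (suc g) N ks∈ with ∈-++⁻ (map (g ∷_) (climbs m g N)) ks∈
... | inj₁ p with ks′ , ks′∈ , eq ← ∈-map⁻ (g ∷_) p = g , ks′ , eq , ≤-refl , ks′∈
... | inj₂ p with k , ks′ , eq , k<g , ks′∈ ← ∈-climbsBelow⁻ m g N p =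
  k , ks′ , eq , m<n⇒m<1+n k<g , ks′∈

∈-climbsBelow⁺ : ∀ m {g k} N {ks} → k < g → ks ∈ climbs m k N → k ∷ ks ∈ climbsBelow m g N
∈-climbsBelow⁺ m {suc g} N (s≤s k≤g) ks∈ with m≤n⇒m<n∨m≡n k≤g
... | inj₁ k<g  = ∈-++⁺ʳ (map (g ∷_) (climbs m g N)) (∈-climbsBelow⁺ m N k<g ks∈)
... | inj₂ refl = ∈-++⁺ˡ (∈-map⁺ (g ∷_) ks∈)

-- Here `d` is the excess of the first value over `g`; its cost `suc d` and the remaining climb `N′`
-- use up the budget.
∈-climbsAbove⁻ : ∀ m g N {ks} → ks ∈ climbsAbove m g N →
                 ∃ λ d → ∃ λ N′ → ∃ λ ks′ →
                 ks ≡ g + d ∷ ks′ × suc d + N′ ≡ N × ks′ ∈ climbs m (g + d) N′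
∈-climbsAbove⁻ m g (suc N) ks∈ with ∈-++⁻ (map (g ∷_) (climbs m g N)) ks∈
... | inj₁ p with ks′ , ks′∈ , eq ← ∈-map⁻ (g ∷_) p =
  0 , N , ks′ , trans eq (cong (_∷ ks′) (sym (+-identityʳ g))) , refl ,
  subst (λ x → ks′ ∈ climbs m x N) (sym (+-identityʳ g)) ks′∈
... | inj₂ p with d , N′ , ks′ , eq , eqN , ks′∈ ← ∈-climbsAbove⁻ m (suc g) N p =
  suc d , N′ , ks′ , trans eq (cong (_∷ ks′) (sym (+-suc g d))) , cong suc eqN ,
  subst (λ x → ks′ ∈ climbs m x N′) (sym (+-suc g d)) ks′∈

∈-climbsAbove⁺ : ∀ m g d N {ks} → ks ∈ climbs m (g + d) N → g + d ∷ ks ∈ climbsAbove m g (suc d + N)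
∈-climbsAbove⁺ m g zero N {ks} ks∈ =
  subst (λ x → ks ∈ climbs m x N → x ∷ ks ∈ climbsAbove m g (suc N)) (sym (+-identityʳ g))
    (λ p → ∈-++⁺ˡ (∈-map⁺ (g ∷_) p)) ks∈
∈-climbsAbove⁺ m g (suc d) N {ks} ks∈ =
  subst (λ x → ks ∈ climbs m x N → x ∷ ks ∈ climbsAbove m g (suc (suc d) + N)) (sym (+-suc g d))
    (λ p → ∈-++⁺ʳ (map (g ∷_) (climbs m g (suc d + N))) (∈-climbsAbove⁺ m (suc g) d N p)) ks∈

∈-climbs⁻ : ∀ m g N {ks} → ks ∈ climbs m g N → length ks ≡ m × climb g ks ≡ N
∈-climbs⁻ zero    g zero (here refl) = refl , refl
∈-climbs⁻ (suc m) g N ks∈ with ∈-++⁻ (climbsBelow m g N) ks∈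
... | inj₁ p with k , ks′ , refl , k<g , ks′∈ ← ∈-climbsBelow⁻ m g N p
             with len , eq ← ∈-climbs⁻ m k N ks′∈ =
  cong suc len , cong₂ _+_ (m≤n⇒m∸n≡0 k<g) eq
... | inj₂ p with d , N′ , ks′ , refl , eqN , ks′∈ ← ∈-climbsAbove⁻ m g N p
             with len , eq ← ∈-climbs⁻ m (g + d) N′ ks′∈ =
  cong suc len ,
  trans (cong₂ _+_ (trans (cong (_∸ g) (sym (+-suc g d))) (m+n∸m≡n g (suc d))) eq) eqN

∈-climbs⁺ : ∀ g ks → ks ∈ climbs (length ks) g (climb g ks)
∈-climbs⁺ g [] = here refl
∈-climbs⁺ g (k ∷ ks) with g ≤? k
... | no g≰k rewrite m≤n⇒m∸n≡0 (≰⇒> g≰k) =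
  ∈-++⁺ˡ (∈-climbsBelow⁺ (length ks) (climb k ks) (≰⇒> g≰k) (∈-climbs⁺ k ks))
... | yes g≤k with d , refl ← m≤n⇒∃[o]m+o≡n g≤k
  rewrite trans (cong (_∸ g) (sym (+-suc g d))) (m+n∸m≡n g (suc d)) =
  ∈-++⁺ʳ (climbsBelow (length ks) g (suc d + climb (g + d) ks))
    (∈-climbsAbove⁺ (length ks) g d (climb (g + d) ks) (∈-climbs⁺ (g + d) ks))

mutual
  climbs-unique : ∀ m g N → Unique (climbs m g N)
  climbs-unique zero    g zero    = [] ∷ []
  climbs-unique zero    g (suc N) = []
  climbs-unique (suc m) g N = Unique.++⁺ (climbsBelow-unique m g N) (climbsAbove-unique m g N) disjoint
    where
    disjoint : ∀ {ks} → ks ∈ climbsBelow m g N × ks ∈ climbsAbove m g N → _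
    disjoint (p , q) with _ , _ , refl , k<g , _ ← ∈-climbsBelow⁻ m g N p
                     with d , _ , _ , refl , _ ← ∈-climbsAbove⁻ m g N q = m+n≮m g d k<g

  climbsBelow-unique : ∀ m g N → Unique (climbsBelow m g N)
  climbsBelow-unique m zero    N = []
  climbsBelow-unique m (suc g) N =
    Unique.++⁺ (Unique.map⁺ ∷-injectiveʳ (climbs-unique m g N)) (climbsBelow-unique m g N) disjoint
    where
    disjoint : ∀ {ks} → ks ∈ map (g ∷_) (climbs m g N) × ks ∈ climbsBelow m g N → _
    disjoint (p , q) with _ , _ , refl ← ∈-map⁻ (g ∷_) p
                     with _ , _ , refl , g<g , _ ← ∈-climbsBelow⁻ m g N q = n≮n g g<g

  climbsAbove-unique : ∀ m g N → Unique (climbsAbove m g N)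
  climbsAbove-unique m g zero    = []
  climbsAbove-unique m g (suc N) =
    Unique.++⁺ (Unique.map⁺ ∷-injectiveʳ (climbs-unique m g N)) (climbsAbove-unique m (suc g) N) disjoint
    where
    disjoint : ∀ {ks} → ks ∈ map (g ∷_) (climbs m g N) × ks ∈ climbsAbove m (suc g) N → _
    disjoint (p , q) with _ , _ , refl ← ∈-map⁻ (g ∷_) p
                     with d , _ , _ , eq , _ ← ∈-climbsAbove⁻ m (suc g) N q =
      m≢1+m+n g (cong head eq)
      where
      head : List ℕ → ℕ
      head []      = 0
      head (k ∷ _) = k

-- Expansion along the Catalan generating tree

∑ : {A : Set} → (A → ℕ) → List A → ℕ
∑ f xs = sum (map f xs)

∑-cong : {A : Set} {f g : A → ℕ} → (∀ x → f x ≡ g x) → ∀ xs → ∑ f xs ≡ ∑ g xs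
∑-cong f≗g []       = refl
∑-cong f≗g (x ∷ xs) = cong₂ _+_ (f≗g x) (∑-cong f≗g xs)

∑-+ : {A : Set} (f g : A → ℕ) → ∀ xs → ∑ (λ x → f x + g x) xs ≡ ∑ f xs + ∑ g xs
∑-+ f g []       = refl
∑-+ f g (x ∷ xs) = trans (cong (f x + g x +_) (∑-+ f g xs)) (interchange (f x) (g x) (∑ f xs) (∑ g xs))
  where
  interchange : ∀ a b c d → (a + b) + (c + d) ≡ (a + c) + (b + d)
  interchange = solve-∀

∑-++ : {A : Set} (f : A → ℕ) → ∀ xs ys → ∑ f (xs ++ ys) ≡ ∑ f xs + ∑ f ys
∑-++ f []       ys = refl
∑-++ f (x ∷ xs) ys = trans (cong (f x +_) (∑-++ f xs ys)) (sym (+-assoc (f x) (∑ f xs) (∑ f ys)))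

∑-concatMap : {A B : Set} (f : B → ℕ) (g : A → List B) → ∀ xs →
              ∑ f (concatMap g xs) ≡ ∑ (λ x → ∑ f (g x)) xs
∑-concatMap f g []       = refl
∑-concatMap f g (x ∷ xs) =
  trans (∑-++ f (g x) (concatMap g xs)) (cong (∑ f (g x) +_) (∑-concatMap f g xs))

∑-const : {A : Set} {f : A → ℕ} {c : ℕ} {xs : List A} → All (λ x → f x ≡ c) xs → ∑ f xs ≡ length xs * c
∑-const []         = refl
∑-const (eq ∷ eqs) = cong₂ _+_ eq (∑-const eqs)

-- The coefficient of z^N in q^r, where q = z / (1 − z).
compositions : ℕ → ℕ → ℕ
compositions zero    zero    = 1
compositions zero    (suc r) = 0
compositions (suc N) zero    = 0
compositions (suc N) (suc r) = compositions N r + compositions N (suc r)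

-- The recurrence of `compositions` is Pascal's rule with both indices shifted by one.
compositions-C : ∀ N r → compositions (suc N) (suc r) ≡ N C r
compositions-C zero    zero    = refl
compositions-C zero    (suc r) = sym (k>n⇒nCk≡0 {0} {suc r} (s≤s z≤n))
compositions-C (suc N) zero    = compositions-C N zero
compositions-C (suc N) (suc r) =
  trans (cong₂ _+_ (compositions-C N r) (compositions-C N (suc r))) (nCk+nC[k+1]≡[n+1]C[k+1] N r)

-- (i , r) stands for q^r (g choose i).
Term : Set
Term = ℕ × ℕ

descend : ℕ → ℕ → List Term
descend zero    r = (zero , r) ∷ []
descend (suc i) r = (suc i , r) ∷ descend i (suc r)

children : Term → List Term
children (i , r) = (suc i , r) ∷ descend i (suc r)

level : ℕ → List Term
level zero    = (0 , 0) ∷ []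
level (suc m) = concatMap children (level m)

⟦_⟧ : Term → ℕ → ℕ → ℕ
⟦ i , r ⟧ g N = compositions N r * (g C i)

-- Every term here carries a positive power of q, and q has no constant term.
descend-0 : ∀ i r g → ∑ (λ t → ⟦ t ⟧ g 0) (descend i (suc r)) ≡ 0
descend-0 zero    r g = refl
descend-0 (suc i) r g = descend-0 i (suc r) g

-- Writing F g for the sum listed by `descend i (suc r)` and f g for q^r (g choose i), this reads F
-- g = z (f g + F (g + 1)), the recursion satisfied by the sum of z^(k - g + 1) f k over k ≥ g. It
-- comes from q = z (1 + q) and Pascal's rule.
descend-suc : ∀ i r g N → ∑ (λ t → ⟦ t ⟧ g (suc N)) (descend i (suc r))
              ≡ ⟦ i , r ⟧ g N + ∑ (λ t → ⟦ t ⟧ (suc g) N) (descend i (suc r))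
descend-suc zero r g N = identity (compositions N r) (compositions N (suc r))
  where
  identity : ∀ a b → (a + b) * 1 + 0 ≡ a * 1 + (b * 1 + 0)
  identity = solve-∀
descend-suc (suc i) r g N = begin
  (a + b) * (g C suc i) + ∑ (λ t → ⟦ t ⟧ g (suc N)) (descend i (suc (suc r)))
    ≡⟨ cong ((a + b) * (g C suc i) +_) (descend-suc i (suc r) g N) ⟩
  (a + b) * (g C suc i) + (b * (g C i) + s)
    ≡⟨ identity a b (g C i) (g C suc i) s ⟩
  a * (g C suc i) + (b * (g C i + g C suc i) + s)
    ≡⟨ cong (λ x → a * (g C suc i) + (b * x + s)) (nCk+nC[k+1]≡[n+1]C[k+1] g i) ⟩
  a * (g C suc i) + (b * (suc g C suc i) + s) ∎
  where
  open ≡-Reasoning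
  a = compositions N r
  b = compositions N (suc r)
  s = ∑ (λ t → ⟦ t ⟧ (suc g) N) (descend i (suc (suc r)))
  identity : ∀ a b x y s → (a + b) * y + (b * x + s) ≡ a * y + (b * (x + y) + s)
  identity = solve-∀

mutual
  length-climbs : ∀ m g N → length (climbs m g N) ≡ ∑ (λ t → ⟦ t ⟧ g N) (level m)
  length-climbs zero    g zero    = refl
  length-climbs zero    g (suc N) = refl
  length-climbs (suc m) g N = begin
    length (climbsBelow m g N ++ climbsAbove m g N)
      ≡⟨ length-++ (climbsBelow m g N) ⟩
    length (climbsBelow m g N) + length (climbsAbove m g N)
      ≡⟨ cong₂ _+_ (length-climbsBelow m g N) (length-climbsAbove m g N) ⟩
    ∑ up (level m) + ∑ down (level m)
      ≡⟨ ∑-+ up down (level m) ⟨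
    ∑ (λ t → ∑ (λ t → ⟦ t ⟧ g N) (children t)) (level m)
      ≡⟨ ∑-concatMap (λ t → ⟦ t ⟧ g N) children (level m) ⟨
    ∑ (λ t → ⟦ t ⟧ g N) (level (suc m)) ∎
    where
    open ≡-Reasoning
    up down : Term → ℕ
    up   (i , r) = ⟦ suc i , r ⟧ g N
    down (i , r) = ∑ (λ t → ⟦ t ⟧ g N) (descend i (suc r))

  -- The hockey-stick identity: (k choose i) summed over k < g is (g choose i + 1). One step in `g`
  -- is Pascal's rule, applied term by term.
  length-climbsBelow : ∀ m g N →
    length (climbsBelow m g N) ≡ ∑ (λ (i , r) → ⟦ suc i , r ⟧ g N) (level m)
  length-climbsBelow m zero N =
    sym (trans (∑-const (All.universal (λ (i , r) →
      trans (cong (compositions N r *_) (k>n⇒nCk≡0 {k = suc i} (s≤s z≤n))) (*-zeroʳ (compositions N r))) (level m)))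
      (*-zeroʳ (length (level m))))
  length-climbsBelow m (suc g) N = begin
    length (map (g ∷_) (climbs m g N) ++ climbsBelow m g N)
      ≡⟨ length-++ (map (g ∷_) (climbs m g N)) ⟩
    length (map (g ∷_) (climbs m g N)) + length (climbsBelow m g N)
      ≡⟨ cong₂ _+_ (trans (length-map (g ∷_) (climbs m g N)) (length-climbs m g N)) (length-climbsBelow m g N) ⟩
    ∑ (λ t → ⟦ t ⟧ g N) (level m) + ∑ (λ (i , r) → ⟦ suc i , r ⟧ g N) (level m)
      ≡⟨ ∑-+ (λ t → ⟦ t ⟧ g N) (λ (i , r) → ⟦ suc i , r ⟧ g N) (level m) ⟨
    ∑ (λ (i , r) → ⟦ i , r ⟧ g N + ⟦ suc i , r ⟧ g N) (level m)
      ≡⟨ ∑-cong (λ (i , r) → trans (sym (*-distribˡ-+ (compositions N r) (g C i) (g C suc i)))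
           (cong (compositions N r *_) (nCk+nC[k+1]≡[n+1]C[k+1] g i))) (level m) ⟩
    ∑ (λ (i , r) → ⟦ suc i , r ⟧ (suc g) N) (level m) ∎
    where open ≡-Reasoning

  -- Induction on the budget `N` with `g` varying, since `climbsAbove` trades one unit of `N` for
  -- one of `g`; each step is `descend-suc`.
  length-climbsAbove : ∀ m g N →
    length (climbsAbove m g N) ≡ ∑ (λ (i , r) → ∑ (λ t → ⟦ t ⟧ g N) (descend i (suc r))) (level m)
  length-climbsAbove m g zero =
    sym (trans (∑-const (All.universal (λ (i , r) → descend-0 i r g) (level m)))
      (*-zeroʳ (length (level m))))
  length-climbsAbove m g (suc N) = begin
    length (map (g ∷_) (climbs m g N) ++ climbsAbove m (suc g) N)
      ≡⟨ length-++ (map (g ∷_) (climbs m g N)) ⟩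
    length (map (g ∷_) (climbs m g N)) + length (climbsAbove m (suc g) N)
      ≡⟨ cong₂ _+_ (trans (length-map (g ∷_) (climbs m g N)) (length-climbs m g N)) (length-climbsAbove m (suc g) N) ⟩
    ∑ (λ t → ⟦ t ⟧ g N) (level m) + ∑ (λ (i , r) → ∑ (λ t → ⟦ t ⟧ (suc g) N) (descend i (suc r))) (level m)
      ≡⟨ ∑-+ (λ t → ⟦ t ⟧ g N) (λ (i , r) → ∑ (λ t → ⟦ t ⟧ (suc g) N) (descend i (suc r))) (level m) ⟨
    ∑ (λ (i , r) → ⟦ i , r ⟧ g N + ∑ (λ t → ⟦ t ⟧ (suc g) N) (descend i (suc r))) (level m)
      ≡⟨ ∑-cong (λ (i , r) → descend-suc i r g N) (level m) ⟨
    ∑ (λ (i , r) → ∑ (λ t → ⟦ t ⟧ g (suc N)) (descend i (suc r))) (level m) ∎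
    where open ≡-Reasoning

descend-degree : ∀ i r → All (λ (j , s) → j + s ≡ i + r) (descend i r)
descend-degree zero    r = refl ∷ []
descend-degree (suc i) r = refl ∷ All.map (λ eq → trans eq (+-suc i r)) (descend-degree i (suc r))

-- Each child raises i + r by one. This is what lets all terms of a level contribute equally at g =
-- 1.
level-degree : ∀ m → All (λ (i , r) → i + r ≡ m) (level m)
level-degree zero    = refl ∷ []
level-degree (suc m) = go (level-degree m)
  where
  go : ∀ {ts} → All (λ (i , r) → i + r ≡ m) ts → All (λ (i , r) → i + r ≡ suc m) (concatMap children ts)
  go []                            = []
  go {(i , r) ∷ _} (refl ∷ degrees) =
    ++⁺ (refl ∷ All.map (λ eq → trans eq (+-suc i r)) (descend-degree i (suc r))) (go degrees)

-- Since (1 choose j) vanishes for j ≥ 2, only the last two terms, (1 , i + r) and (0 , 1 + i + r),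
-- survive.
descend-at-1 : ∀ i r N → ∑ (λ t → ⟦ t ⟧ 1 N) (descend (suc i) r)
               ≡ compositions N (i + r) + compositions N (suc i + r)
descend-at-1 zero    r N = identity (compositions N r) (compositions N (suc r))
  where
  identity : ∀ a b → a * 1 + (b * 1 + 0) ≡ a + b
  identity = solve-∀
descend-at-1 (suc i) r N = begin
  compositions N r * (1 C suc (suc i)) + ∑ (λ t → ⟦ t ⟧ 1 N) (descend (suc i) (suc r))
    ≡⟨ cong₂ _+_ (trans (cong (compositions N r *_) (k>n⇒nCk≡0 {k = suc (suc i)} (s≤s (s≤s z≤n)))) (*-zeroʳ (compositions N r)))
         (descend-at-1 i (suc r) N) ⟩
  compositions N (i + suc r) + compositions N (suc i + suc r)
    ≡⟨ cong₂ _+_ (cong (compositions N) (+-suc i r)) (cong (compositions N) (cong suc (+-suc i r))) ⟩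
  compositions N (suc i + r) + compositions N (suc (suc i) + r) ∎
  where open ≡-Reasoning

length-climbs-1 : ∀ m N → length (climbs (suc m) 1 N) ≡ length (level m) * (N C m)
length-climbs-1 m N = begin
  length (climbs (suc m) 1 N)
    ≡⟨ length-climbs (suc m) 1 N ⟩
  ∑ (λ t → ⟦ t ⟧ 1 N) (concatMap children (level m))
    ≡⟨ ∑-concatMap (λ t → ⟦ t ⟧ 1 N) children (level m) ⟩
  ∑ (λ t → ∑ (λ t → ⟦ t ⟧ 1 N) (children t)) (level m)
    ≡⟨ ∑-const (All.map (λ {t} → children-at-1 t) (level-degree m)) ⟩
  length (level m) * (N C m) ∎
  where
  open ≡-Reasoning
  children-at-1 : ∀ t → proj₁ t + proj₂ t ≡ m → ∑ (λ t → ⟦ t ⟧ 1 N) (children t) ≡ N C m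
  -- `children (i , r)` unfolds to `descend (suc i) r`, and the two surviving coefficients add up to
  -- `compositions (suc N) (suc (i + r))`: this is q^m (1 + q) = q^(m+1) / z.
  children-at-1 (i , r) refl = trans (descend-at-1 i r N) (compositions-C N (i + r))

-- Ballot numbers

-- The number of descendants, `m` generations below, of a node labelled `i` in the Catalan tree. The
-- recursion is telescoped: the children of i + 1 are i + 2 and the children of i.
ballot : ℕ → ℕ → ℕ
ballot zero    i       = 1
ballot (suc m) zero    = ballot m 1 + ballot m 0
ballot (suc m) (suc i) = ballot m (suc (suc i)) + ballot (suc m) i

ballot-suc : ∀ m i r → ballot (suc m) i ≡ ∑ (λ (j , _) → ballot m j) (children (i , r))
ballot-suc m i r = trans (split i) (cong (ballot m (suc i) +_) (lower i (suc r)))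
  where
  below : ℕ → ℕ
  below zero    = ballot m 0
  below (suc i) = ballot m (suc i) + below i

  split : ∀ i → ballot (suc m) i ≡ ballot m (suc i) + below i
  split zero    = refl
  split (suc i) = cong (ballot m (suc (suc i)) +_) (split i)

  lower : ∀ i r → below i ≡ ∑ (λ (j , _) → ballot m j) (descend i r)
  lower zero    r = sym (+-identityʳ (ballot m 0))
  lower (suc i) r = cong (ballot m (suc i) +_) (lower i (suc r))

-- The nodes of level k + m are grouped by their ancestors in level k. For m = 0 every node counts
-- once, which gives the size of a level.
∑-ballot-level : ∀ m k → ∑ (λ (i , _) → ballot m i) (level k) ≡ ballot (k + m) 0
∑-ballot-level m zero    = +-identityʳ (ballot m 0)
∑-ballot-level m (suc k) = begin
  ∑ (λ (i , _) → ballot m i) (concatMap children (level k))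
    ≡⟨ ∑-concatMap (λ (i , _) → ballot m i) children (level k) ⟩
  ∑ (λ t → ∑ (λ (i , _) → ballot m i) (children t)) (level k)
    ≡⟨ ∑-cong (λ (i , r) → ballot-suc m i r) (level k) ⟨
  ∑ (λ (i , _) → ballot (suc m) i) (level k)
    ≡⟨ ∑-ballot-level (suc m) k ⟩
  ballot (k + suc m) 0
    ≡⟨ cong (λ x → ballot x 0) (+-suc k m) ⟩
  ballot (suc k + m) 0 ∎
  where open ≡-Reasoning

length-level : ∀ m → length (level m) ≡ ballot m 0
length-level m = begin
  length (level m)
    ≡⟨ *-identityʳ (length (level m)) ⟨
  length (level m) * 1
    ≡⟨ ∑-const {f = λ _ → 1} (All.universal (λ _ → refl) (level m)) ⟨
  ∑ (λ (i , _) → ballot 0 i) (level m)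
    ≡⟨ ∑-ballot-level 0 m ⟩
  ballot (m + 0) 0
    ≡⟨ cong (λ x → ballot x 0) (+-identityʳ m) ⟩
  ballot m 0 ∎
  where open ≡-Reasoning

-- Binomial identities, reflection and Catalan numbers

+-rearrange : ∀ p q a c {b d} → p + a ≡ b → q + c ≡ d → (p + q) + (a + c) ≡ b + d
+-rearrange p q a c refl refl = identity p q a c
  where
  identity : ∀ p q a c → (p + q) + (a + c) ≡ (p + a) + (q + c)
  identity = solve-∀

-- The ratio rule (k + 1) (n choose k + 1) = (n - k) (n choose k), freed of subtraction; Pascal's
-- rule carries the induction on `n`.
C-absorption : ∀ n k → suc k * (n C suc k) + k * (n C k) ≡ n * (n C k)
C-absorption zero zero = refl
C-absorption zero (suc k) = cong₂ _+_
  (trans (cong (suc (suc k) *_) (k>n⇒nCk≡0 {0} {suc (suc k)} (s≤s z≤n))) (*-zeroʳ (suc (suc k))))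
  (trans (cong (suc k *_) (k>n⇒nCk≡0 {0} {suc k} (s≤s z≤n))) (*-zeroʳ (suc k)))
C-absorption (suc n) zero = begin
  1 * (suc n C 1) + 0 ≡⟨ identity (suc n C 1) ⟩
  suc n C 1           ≡⟨ nC1≡n (suc n) ⟩
  suc n               ≡⟨ *-identityʳ (suc n) ⟨
  suc n * 1           ∎
  where
  open ≡-Reasoning
  identity : ∀ x → 1 * x + 0 ≡ x
  identity = solve-∀
C-absorption (suc n) (suc k) = begin
  (2 + k) * (suc n C (2 + k)) + (1 + k) * (suc n C (1 + k))
    ≡⟨ cong₂ (λ x y → (2 + k) * x + (1 + k) * y)
         (nCk+nC[k+1]≡[n+1]C[k+1] n (suc k)) (nCk+nC[k+1]≡[n+1]C[k+1] n k) ⟨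
  (2 + k) * (b + c) + (1 + k) * (a + b)
    ≡⟨ regroup k a b c ⟩
  ((2 + k) * c + (1 + k) * b) + ((1 + k) * b + k * a) + (a + b)
    ≡⟨ cong₂ (λ x y → x + y + (a + b)) (C-absorption n (suc k)) (C-absorption n k) ⟩
  n * b + n * a + (a + b)
    ≡⟨ collect n a b ⟩
  suc n * (a + b)
    ≡⟨ cong (suc n *_) (nCk+nC[k+1]≡[n+1]C[k+1] n k) ⟩
  suc n * (suc n C suc k) ∎
  where
  open ≡-Reasoning
  a = n C k
  b = n C suc k
  c = n C suc (suc k)
  regroup : ∀ k a b c → (2 + k) * (b + c) + (1 + k) * (a + b)
                      ≡ ((2 + k) * c + (1 + k) * b) + ((1 + k) * b + k * a) + (a + b)
  regroup = solve-∀
  collect : ∀ n a b → n * b + n * a + (a + b) ≡ suc n * (a + b)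
  collect = solve-∀

-- The reflection principle, ballot m i = C(2m+i+1, m) − C(2m+i+1, m−1); the case i = 0
-- also reads C(2m+2, m+1) − C(2m+2, m), because the row 2m+1 is symmetric.
mutual
  ballot-reflection : ∀ m i {n} → 3 + i + (m + m) ≡ n → ballot (suc m) i + n C m ≡ n C suc m
  ballot-reflection zero i refl = begin
    ballot 1 i + 1          ≡⟨ cong (_+ 1) (ballot-1 i) ⟩
    2 + i + 1               ≡⟨ identity i ⟩
    3 + i + 0               ≡⟨ nC1≡n (3 + i + 0) ⟨
    (3 + i + 0) C 1         ∎
    where
    open ≡-Reasoning
    ballot-1 : ∀ i → ballot 1 i ≡ 2 + i
    ballot-1 zero    = refl
    ballot-1 (suc i) = cong suc (ballot-1 i)
    identity : ∀ i → 2 + i + 1 ≡ 3 + i + 0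
    identity = solve-∀
  ballot-reflection (suc m) zero {suc n} eq = begin
    ballot (suc m) 1 + ballot (suc m) 0 + suc n C suc m
      ≡⟨ cong (ballot (suc m) 1 + ballot (suc m) 0 +_) (nCk+nC[k+1]≡[n+1]C[k+1] n m) ⟨
    ballot (suc m) 1 + ballot (suc m) 0 + (n C m + n C suc m)
      -- Both summands must be read in row 2m + 4. For label 0 the reflection formula uses row 2m +
      -- 3, so `ballot-central` supplies the second one.
      ≡⟨ +-rearrange (ballot (suc m) 1) (ballot (suc m) 0) (n C m) (n C suc m)
           (ballot-reflection m 1 (trans (identity m) (suc-injective eq)))
           (ballot-central (suc m) (suc-injective eq)) ⟩
    n C suc m + n C suc (suc m)
      ≡⟨ nCk+nC[k+1]≡[n+1]C[k+1] n (suc m) ⟩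
    suc n C suc (suc m) ∎
    where
    open ≡-Reasoning
    identity : ∀ m → 3 + 1 + (m + m) ≡ 2 + (suc m + suc m)
    identity = solve-∀
  ballot-reflection (suc m) (suc i) {suc n} eq = begin
    ballot (suc m) (2 + i) + ballot (2 + m) i + suc n C suc m
      ≡⟨ cong (ballot (suc m) (2 + i) + ballot (2 + m) i +_) (nCk+nC[k+1]≡[n+1]C[k+1] n m) ⟨
    ballot (suc m) (2 + i) + ballot (2 + m) i + (n C m + n C suc m)
      ≡⟨ +-rearrange (ballot (suc m) (2 + i)) (ballot (2 + m) i) (n C m) (n C suc m)
           (ballot-reflection m (2 + i) (trans (identity m i) (suc-injective eq)))
           (ballot-reflection (suc m) i (suc-injective eq)) ⟩
    n C suc m + n C suc (suc m)
      ≡⟨ nCk+nC[k+1]≡[n+1]C[k+1] n (suc m) ⟩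
    suc n C suc (suc m) ∎
    where
    open ≡-Reasoning
    identity : ∀ m i → 3 + (2 + i) + (m + m) ≡ 3 + i + (suc m + suc m)
    identity = solve-∀

  ballot-central : ∀ m {n} → 2 + (m + m) ≡ n → ballot m 0 + n C m ≡ n C suc m
  ballot-central zero    refl       = refl
  ballot-central (suc m) {suc n} eq = begin
    ballot (suc m) 0 + suc n C suc m
      ≡⟨ cong (ballot (suc m) 0 +_) (nCk+nC[k+1]≡[n+1]C[k+1] n m) ⟨
    ballot (suc m) 0 + (n C m + n C suc m)
      ≡⟨ +-assoc (ballot (suc m) 0) (n C m) (n C suc m) ⟨
    ballot (suc m) 0 + n C m + n C suc m
      ≡⟨ cong₂ _+_ (ballot-reflection m 0 n≡) symmetry ⟩
    n C suc m + n C suc (suc m)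
      ≡⟨ nCk+nC[k+1]≡[n+1]C[k+1] n (suc m) ⟩
    suc n C suc (suc m) ∎
    where
    open ≡-Reasoning
    n≡ : 3 + (m + m) ≡ n
    n≡ = trans (identity m) (suc-injective eq)
      where
      identity : ∀ m → 3 + (m + m) ≡ 1 + (suc m + suc m)
      identity = solve-∀
    sides : suc m + suc (suc m) ≡ n
    sides = trans (identity m) n≡
      where
      identity : ∀ m → suc m + suc (suc m) ≡ 3 + (m + m)
      identity = solve-∀
    symmetry : n C suc m ≡ n C suc (suc m)
    symmetry = trans (nCk≡nC[n∸k] (subst (suc m ≤_) sides (m≤m+n (suc m) (suc (suc m)))))
      (cong (n C_) (trans (cong (_∸ suc m) (sym sides)) (m+n∸m≡n (suc m) (suc (suc m)))))

-- Let c = X - Y be the ballot number, with X and Y the entries m + 1 and m of row 2m + 2.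
-- Absorption gives (m + 1) X = (m + 2) Y, hence (m + 1) c = Y and (m + 2) c = X, so the division in
-- `catalan` is exact.
catalan-ballot : ∀ m → catalan (suc m) ≡ ballot m 0
catalan-ballot m = trans (cong (_/ (2 + m)) (sym central)) (m*n/n≡m (ballot m 0) (2 + m))
  where
  n c X Y : ℕ
  n = 2 * suc m
  c = ballot m 0
  X = n C suc m
  Y = n C m
  n≡ : ∀ m → 2 + (m + m) ≡ 2 * suc m
  n≡ = solve-∀
  reflected : c + Y ≡ X
  reflected = ballot-central m (n≡ m)
  Y≡ : (1 + m) * c ≡ Y
  Y≡ = +-cancelʳ-≡ ((1 + 2 * m) * Y) ((1 + m) * c) Y (begin
    (1 + m) * c + (1 + 2 * m) * Y ≡⟨ regroup m c Y ⟩
    (1 + m) * (c + Y) + m * Y     ≡⟨ cong (λ x → (1 + m) * x + m * Y) reflected ⟩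
    (1 + m) * X + m * Y           ≡⟨ C-absorption n m ⟩
    n * Y                         ≡⟨ collect m Y ⟩
    Y + (1 + 2 * m) * Y           ∎)
    where
    open ≡-Reasoning
    regroup : ∀ m c Y → (1 + m) * c + (1 + 2 * m) * Y ≡ (1 + m) * (c + Y) + m * Y
    regroup = solve-∀
    collect : ∀ m Y → 2 * suc m * Y ≡ Y + (1 + 2 * m) * Y
    collect = solve-∀
  central : c * (2 + m) ≡ X
  central = begin
    c * (2 + m)       ≡⟨ *-comm c (2 + m) ⟩
    c + (1 + m) * c   ≡⟨ cong (c +_) Y≡ ⟩
    c + Y             ≡⟨ reflected ⟩
    X                 ∎
    where open ≡-Reasoning

length-climbs-catalan : ∀ m N → length (climbs (suc m) 1 N) ≡ catalan (suc m) * (N C m)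
length-climbs-catalan m N =
  trans (length-climbs-1 m N) (cong (_* (N C m)) (trans (length-level m) (sym (catalan-ballot m))))

-- Polyominoes and their boundaries

open import Data.Integer as ℤ using (ℤ; +_; -[1+_]; ∣_∣; 0ℤ; 1ℤ; -1ℤ)
import Data.Integer.Properties as ℤ
open import Data.Integer.Tactic.RingSolver using () renaming (solve-∀ to ℤ-solve-∀)
open import Algebra.Properties.AbelianGroup ℤ.+-0-abelianGroup using () renaming (∙-cancelʳ to ℤ-+-cancelʳ)

-- Cardinalities of lists without repetitions

lookup-injective : {A : Set} {xs : List A} → Unique xs → ∀ {i j} → lookup xs i ≡ lookup xs j → i ≡ j
lookup-injective (x∉ ∷ _) {zero}  {zero}  eq = refl
lookup-injective (x∉ ∷ _) {zero}  {suc j} eq = contradiction eq (All.lookup x∉ (∈-lookup j))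
lookup-injective (x∉ ∷ _) {suc i} {zero}  eq = contradiction (sym eq) (All.lookup x∉ (∈-lookup i))
lookup-injective (_ ∷ u)  {suc i} {suc j} eq = cong suc (lookup-injective u eq)

-- Pigeonhole: sending each position in `xs` to a position of the same element in `ys` is injective,
-- because `xs` has no repetitions.
length-⊆ : {A : Set} {xs ys : List A} → Unique xs → (∀ {x} → x ∈ xs → x ∈ ys) → length xs ≤ length ys
length-⊆ {xs = xs} {ys} u xs⊆ys = injective⇒≤ {f = position} (λ {i} {j} eq →
  lookup-injective u (trans (lookup-index (xs⊆ys (∈-lookup i)))
    (trans (cong (lookup ys) eq) (sym (lookup-index (xs⊆ys (∈-lookup j)))))))
  where
  position : Fin (length xs) → Fin (length ys)
  position i = Any.index (xs⊆ys (∈-lookup i))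

length-bijection : {A B : Set} {xs : List A} {ys : List B} (f : A → B) →
                   (∀ {x y} → f x ≡ f y → x ≡ y) → Unique xs → Unique ys →
                   (∀ {x} → x ∈ xs → f x ∈ ys) → (∀ {y} → y ∈ ys → ∃ λ x → x ∈ xs × y ≡ f x) →
                   length xs ≡ length ys
length-bijection {xs = xs} {ys} f inj uxs uys into onto =
  trans (sym (length-map f xs)) (≤-antisym
    (length-⊆ (Unique.map⁺ inj uxs) image⊆)
    (length-⊆ uys (λ y∈ → let x , x∈ , eq = onto y∈ in subst (_∈ map f xs) (sym eq) (∈-map⁺ f x∈))))
  where
  image⊆ : ∀ {y} → y ∈ map f xs → y ∈ ys
  image⊆ y∈ with x , x∈ , refl ← ∈-map⁻ f y∈ = into x∈

length-1⇒≡ : {A : Set} {xs : List A} {x y : A} → length xs ≡ 1 → x ∈ xs → y ∈ xs → x ≡ y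
length-1⇒≡ {xs = _ ∷ []} refl (here refl) (here refl) = refl

≡⇒length-1 : {A : Set} {xs : List A} {x : A} → Unique xs → x ∈ xs → (∀ {y} → y ∈ xs → y ≡ x) → length xs ≡ 1
≡⇒length-1 {xs = _ ∷ []}         u                  x∈ all≡ = refl
≡⇒length-1 {xs = _ ∷ _ ∷ _} ((y≢z ∷ _) ∷ _) x∈ all≡ =
  contradiction (trans (all≡ (here refl)) (sym (all≡ (there (here refl))))) y≢z

length-filter-⇔ : {A : Set} {P Q : A → Set} (P? : Decidable P) (Q? : Decidable Q) (xs : List A) →
                  (∀ {x} → x ∈ xs → P x ⇔ Q x) → length (filter P? xs) ≡ length (filter Q? xs)
length-filter-⇔ P? Q? []       P⇔Q = refl
length-filter-⇔ P? Q? (x ∷ xs) P⇔Q with P? x | Q? x | length-filter-⇔ P? Q? xs (P⇔Q ∘ there)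
... | yes _ | yes _ | eq = cong suc eq
... | no  _ | no  _ | eq = eq
... | yes p | no ¬q | _  = contradiction (to (P⇔Q (here refl)) p) ¬q
... | no ¬p | yes q | _  = contradiction (from (P⇔Q (here refl)) q) ¬p

length-filter-¬ : {A : Set} {P : A → Set} (P? : Decidable P) (xs : List A) →
                  length (filter P? xs) + length (filter (λ x → ¬? (P? x)) xs) ≡ length xs
length-filter-¬ P? [] = refl
length-filter-¬ P? (x ∷ xs) with P? x
... | yes _ = cong suc (length-filter-¬ P? xs)
... | no  _ = trans (+-suc _ _) (cong suc (length-filter-¬ P? xs))

length-filter-concatMap₂ : {A B : Set} {P : B → Set} (P? : Decidable P) (f g : A → B) (xs : List A) →
  length (filter P? (concatMap (λ x → f x ∷ g x ∷ []) xs))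
  ≡ length (filter (P? ∘ f) xs) + length (filter (P? ∘ g) xs)
length-filter-concatMap₂ P? f g [] = refl
length-filter-concatMap₂ P? f g (x ∷ xs) with P? (f x) | length-filter-concatMap₂ P? f g xs
... | yes _ | ih with P? (g x)
...   | yes _ = cong suc (trans (cong suc ih) (sym (+-suc _ _)))
...   | no  _ = cong suc ih
length-filter-concatMap₂ P? f g (x ∷ xs) | no _ | ih with P? (g x)
...   | yes _ = trans (cong suc ih) (sym (+-suc _ _))
...   | no  _ = ih

translate-injective : ∀ v {c d} → translate v c ≡ translate v d → c ≡ d
translate-injective (u , w) eq =
  cong₂ _,_ (ℤ-+-cancelʳ u _ _ (cong proj₁ eq)) (ℤ-+-cancelʳ w _ _ (cong proj₂ eq))

translate-surjective : ∀ v d → ∃ λ c → d ≡ translate v c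
translate-surjective (u , w) (x , y) = (x ℤ.- u , y ℤ.- w) , cong₂ _,_ (cancel x u) (cancel y w)
  where
  cancel : ∀ i j → i ≡ i ℤ.- j ℤ.+ j
  cancel = ℤ-solve-∀

-- Both directions are treated at once: `next` is the step up or to the right, and by the naming of
-- edges the two parallel edges of a cell `c` are called `c` and `next c`.
module Boundary (next prev : Cell → Cell)
                (prev-next : ∀ c → prev (next c) ≡ c) (next-prev : ∀ c → next (prev c) ≡ c)
                (next-≢ : ∀ c → next c ≢ c) where

  edges : Cell → List Edge
  edges c = c ∷ next c ∷ []

  exposed : List Cell → List Cell
  exposed cs = filter (λ c → ¬? (prev c ∈? cs)) cs

  -- A boundary edge is the first edge of a cell without predecessor or the second edge of a cell
  -- without successor. Both kinds are equally numerous, because `prev` matches the cells having a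
  -- predecessor with those having a successor.
  length-boundary : ∀ {cs} → Unique cs → length (boundary edges cs) ≡ 2 * length (exposed cs)
  length-boundary {cs} u = begin
    length (boundary edges cs)
      ≡⟨ length-filter-concatMap₂ single? (λ c → c) next cs ⟩
    length (filter single? cs) + length (filter (single? ∘ next) cs)
      ≡⟨ cong₂ _+_ (length-filter-⇔ single? (λ c → ¬? (prev c ∈? cs)) cs first)
                   (length-filter-⇔ (single? ∘ next) (λ c → ¬? (next c ∈? cs)) cs second) ⟩
    length (exposed cs) + length (filter (λ c → ¬? (next c ∈? cs)) cs)
      ≡⟨ cong (λ k → length (exposed cs) + k) sides ⟨
    length (exposed cs) + length (exposed cs)
      ≡⟨ cong (λ k → length (exposed cs) + k) (+-identityʳ _) ⟨
    2 * length (exposed cs) ∎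
    where
    open ≡-Reasoning

    owners : Edge → List Cell
    owners e = filter (λ c → e ∈? edges c) cs

    single? : Decidable (λ e → length (owners e) ≡ 1)
    single? e = length (owners e) ≟ 1

    ∈-edges : ∀ {e c} → e ∈ edges c → c ≡ e ⊎ c ≡ prev e
    ∈-edges (here refl)         = inj₁ refl
    ∈-edges (there (here refl)) = inj₂ (sym (prev-next _))

    first : ∀ {c} → c ∈ cs → length (owners c) ≡ 1 ⇔ (¬ (prev c ∈ cs))
    first {c} c∈ = mk⇔
      -- A predecessor in the list would own the edge `c` as well, and uniqueness of the owner would
      -- identify it with `c`.
      (λ one p∈ → next-≢ (prev c) (trans (next-prev c)
        (length-1⇒≡ one c∈owners (∈-filter⁺ (λ d → c ∈? edges d) p∈ (there (here (sym (next-prev c))))))))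
      (λ p∉ → ≡⇒length-1 (Unique.filter⁺ (λ d → c ∈? edges d) u) c∈owners (only p∉))
      where
      c∈owners : c ∈ owners c
      c∈owners = ∈-filter⁺ (λ d → c ∈? edges d) c∈ (here refl)
      only : ¬ (prev c ∈ cs) → ∀ {d} → d ∈ owners c → d ≡ c
      only p∉ d∈ with d∈cs , c∈d ← ∈-filter⁻ (λ d → c ∈? edges d) {xs = cs} d∈ with ∈-edges c∈d
      ... | inj₁ eq   = eq
      ... | inj₂ refl = contradiction d∈cs p∉

    second : ∀ {c} → c ∈ cs → length (owners (next c)) ≡ 1 ⇔ (¬ (next c ∈ cs))
    second {c} c∈ = mk⇔
      (λ one n∈ → next-≢ c (length-1⇒≡ one (∈-filter⁺ (λ d → next c ∈? edges d) n∈ (here refl)) c∈owners))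
      (λ n∉ → ≡⇒length-1 (Unique.filter⁺ (λ d → next c ∈? edges d) u) c∈owners (only n∉))
      where
      c∈owners : c ∈ owners (next c)
      c∈owners = ∈-filter⁺ (λ d → next c ∈? edges d) c∈ (there (here refl))
      only : ¬ (next c ∈ cs) → ∀ {d} → d ∈ owners (next c) → d ≡ c
      only n∉ d∈ with d∈cs , c∈d ← ∈-filter⁻ (λ d → next c ∈? edges d) {xs = cs} d∈ with ∈-edges c∈d
      ... | inj₁ refl = contradiction d∈cs n∉
      ... | inj₂ eq   = trans eq (prev-next c)

    covered : length (filter (λ c → prev c ∈? cs) cs) ≡ length (filter (λ c → next c ∈? cs) cs)
    covered = length-bijection prev
      (λ {c} {d} eq → trans (sym (next-prev c)) (trans (cong next eq) (next-prev d)))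
      (Unique.filter⁺ _ u) (Unique.filter⁺ _ u)
      (λ {c} c∈ → let c∈cs , p∈cs = ∈-filter⁻ (λ c → prev c ∈? cs) {xs = cs} c∈ in
        ∈-filter⁺ (λ c → next c ∈? cs) p∈cs (subst (_∈ cs) (sym (next-prev c)) c∈cs))
      (λ {c} c∈ → let c∈cs , n∈cs = ∈-filter⁻ (λ c → next c ∈? cs) {xs = cs} c∈ in
        next c , ∈-filter⁺ (λ c → prev c ∈? cs) n∈cs (subst (_∈ cs) (sym (prev-next c)) c∈cs) , sym (prev-next c))

    sides : length (exposed cs) ≡ length (filter (λ c → ¬? (next c ∈? cs)) cs)
    sides = +-cancelˡ-≡ (length (filter (λ c → prev c ∈? cs) cs)) _ _
      (trans (length-filter-¬ (λ c → prev c ∈? cs) cs)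
      (trans (sym (length-filter-¬ (λ c → next c ∈? cs) cs))
             (cong (_+ length (filter (λ c → ¬? (next c ∈? cs)) cs)) (sym covered))))

  exposed-≈ : (∀ v c → prev (translate v c) ≡ translate v (prev c)) →
              ∀ {P Q} → P ≈ Q → length (exposed (cells P)) ≡ length (exposed (cells Q))
  exposed-≈ prev-translate {P} {Q} (v , f) = length-bijection (translate v) (translate-injective v)
    (Unique.filter⁺ _ (unique P)) (Unique.filter⁺ _ (unique Q))
    (λ {c} c∈ → let c∈P , p∉P = ∈-filter⁻ (λ c → ¬? (prev c ∈? cells P)) {xs = cells P} c∈ in
      ∈-filter⁺ (λ c → ¬? (prev c ∈? cells Q)) (to (f c) c∈P)
        (λ p∈Q → p∉P (from (f (prev c)) (subst (_∈ cells Q) (prev-translate v c) p∈Q))))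
    onto
    where
    onto : ∀ {d} → d ∈ exposed (cells Q) → ∃ λ c → c ∈ exposed (cells P) × d ≡ translate v c
    onto {d} d∈ with c , refl ← translate-surjective v d =
      let d∈Q , p∉Q = ∈-filter⁻ (λ c → ¬? (prev c ∈? cells Q)) {xs = cells Q} d∈ in
      c , ∈-filter⁺ (λ c → ¬? (prev c ∈? cells P)) (from (f c) d∈Q)
            (λ p∈P → p∉Q (subst (_∈ cells Q) (sym (prev-translate v c)) (to (f (prev c)) p∈P))) , refl

up up⁻¹ right right⁻¹ : Cell → Cell
up      (x , y) = x , y ℤ.+ 1ℤ
up⁻¹    (x , y) = x , y ℤ.+ -1ℤ
right   (x , y) = x ℤ.+ 1ℤ , y
right⁻¹ (x , y) = x ℤ.+ -1ℤ , y

i+1-1≡i : ∀ i → i ℤ.+ 1ℤ ℤ.+ -1ℤ ≡ i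
i+1-1≡i = ℤ-solve-∀

i-1+1≡i : ∀ i → i ℤ.+ -1ℤ ℤ.+ 1ℤ ≡ i
i-1+1≡i = ℤ-solve-∀

i+1≢i : ∀ i → i ℤ.+ 1ℤ ≢ i
i+1≢i i eq = contradiction (trans (sym (cancel i)) (trans (cong (ℤ._- i) eq) (ℤ.+-inverseʳ i))) (λ ())
  where
  cancel : ∀ i → i ℤ.+ 1ℤ ℤ.- i ≡ 1ℤ
  cancel = ℤ-solve-∀

module Horizontal = Boundary up up⁻¹
  (λ (x , y) → cong (x ,_) (i+1-1≡i y)) (λ (x , y) → cong (x ,_) (i-1+1≡i y))
  (λ (x , y) → i+1≢i y ∘ cong proj₂)

module Vertical = Boundary right right⁻¹
  (λ (x , y) → cong (_, y) (i+1-1≡i x)) (λ (x , y) → cong (_, y) (i-1+1≡i x))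
  (λ (x , y) → i+1≢i x ∘ cong proj₁)

horizontal-exposed : ∀ P m → HasHorizontalSemiperimeter P m ⇔ length (Horizontal.exposed (cells P)) ≡ m
horizontal-exposed P m = mk⇔
  (λ eq → *-cancelˡ-≡ _ _ 2 (trans (sym (Horizontal.length-boundary (unique P))) eq))
  (λ eq → trans (Horizontal.length-boundary (unique P)) (cong (2 *_) eq))

vertical-exposed : ∀ P n → HasVerticalSemiperimeter P n ⇔ length (Vertical.exposed (cells P)) ≡ n
vertical-exposed P n = mk⇔
  (λ eq → *-cancelˡ-≡ _ _ 2 (trans (sym (Vertical.length-boundary (unique P))) eq))
  (λ eq → trans (Vertical.length-boundary (unique P)) (cong (2 *_) eq))

-- Invariance under translation

columnHeight-≈ : ∀ {P Q} ((v , f) : P ≈ Q) → ∀ x → columnHeight P x ≡ columnHeight Q (x ℤ.+ proj₁ v)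
columnHeight-≈ {P} {Q} (v@(u , _) , f) x = length-bijection (translate v) (translate-injective v)
  (Unique.filter⁺ _ (unique P)) (Unique.filter⁺ _ (unique Q))
  (λ {c} c∈ → let c∈P , eq = ∈-filter⁻ (λ c → proj₁ c ℤ.≟ x) {xs = cells P} c∈ in
    ∈-filter⁺ (λ c → proj₁ c ℤ.≟ x ℤ.+ u) (to (f c) c∈P) (cong (ℤ._+ u) eq))
  onto
  where
  onto : ∀ {d} → d ∈ filter (λ c → proj₁ c ℤ.≟ x ℤ.+ u) (cells Q) →
         ∃ λ c → c ∈ filter (λ c → proj₁ c ℤ.≟ x) (cells P) × d ≡ translate v c
  onto {d} d∈ with c , refl ← translate-surjective v d =
    let d∈Q , eq = ∈-filter⁻ (λ c → proj₁ c ℤ.≟ x ℤ.+ u) {xs = cells Q} d∈ in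
    c , ∈-filter⁺ (λ c → proj₁ c ℤ.≟ x) (from (f c) d∈Q) (ℤ-+-cancelʳ u _ _ eq) , refl

LastColumnHeight-≈ : ∀ {H P Q} → P ≈ Q → LastColumnHeight H P → LastColumnHeight H Q
LastColumnHeight-≈ {H} {P} {Q} P≈Q@(v@(u , w) , f) (x , ((y , xy∈P) , rightmost) , h) =
  x ℤ.+ u , ((y ℤ.+ w , to (f (x , y)) xy∈P) , rightmost′) , subst H (columnHeight-≈ {P} {Q} P≈Q x) h
  where
  rightmost′ : ∀ {d} → d ∈ cells Q → proj₁ d ℤ.≤ x ℤ.+ u
  rightmost′ {d} d∈ with c , refl ← translate-surjective v d = ℤ.+-monoˡ-≤ u (rightmost (from (f c) d∈))

IsFibonacci-≈ : ∀ {P Q} → P ≈ Q → IsFibonacci P → IsFibonacci Q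
IsFibonacci-≈ {P} {Q} (v@(u , w) , f) (convex , rising) = convex′ , rising′
  where
  cancel : ∀ i j → i ℤ.- j ℤ.+ j ≡ i
  cancel = ℤ-solve-∀

  swap : ∀ i j k → i ℤ.+ j ℤ.- k ≡ i ℤ.- k ℤ.+ j
  swap = ℤ-solve-∀

  pull : ∀ {x y} → (x , y) ∈ cells Q → (x ℤ.- u , y ℤ.- w) ∈ cells P
  pull {x} {y} d∈ = from (f _) (subst (_∈ cells Q) (sym (cong₂ _,_ (cancel x u) (cancel y w))) d∈)

  push : ∀ {x y} → (x ℤ.- u , y ℤ.- w) ∈ cells P → (x , y) ∈ cells Q
  push {x} {y} c∈ = subst (_∈ cells Q) (cong₂ _,_ (cancel x u) (cancel y w)) (to (f _) c∈)

  pull-bottom : ∀ {x y} → IsBottom Q (x , y) → IsBottom P (x ℤ.- u , y ℤ.- w)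
  pull-bottom {x} {y} (d∈ , low) = pull d∈ , λ y′ c∈ →
    subst (y ℤ.- w ℤ.≤_) (swap′ y′ w)
      (ℤ.+-monoˡ-≤ (ℤ.- w) (low (y′ ℤ.+ w) (subst (λ z → (z , y′ ℤ.+ w) ∈ cells Q) (cancel x u) (to (f _) c∈))))
    where
    swap′ : ∀ i j → i ℤ.+ j ℤ.- j ≡ i
    swap′ = ℤ-solve-∀

  convex′ : ColumnConvex Q
  convex′ p q y₁≤y y≤y₂ = push (convex (pull p) (pull q) (ℤ.+-monoˡ-≤ (ℤ.- w) y₁≤y) (ℤ.+-monoˡ-≤ (ℤ.- w) y≤y₂))

  rising′ : BottomsRiseByOne Q
  rising′ {x} {y} {y′} p q = ℤ-+-cancelʳ (ℤ.- w) _ _ (trans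
    (rising (pull-bottom p) (subst (λ z → IsBottom P (z , y′ ℤ.- w)) (swap x 1ℤ u) (pull-bottom q)))
    (sym (swap y 1ℤ w)))

FibonacciOfSize-≈ : ∀ {m n P Q} → P ≈ Q → FibonacciOfSize m n P → FibonacciOfSize m n Q
FibonacciOfSize-≈ {m} {n} {P} {Q} P≈Q (fib , hor , ver) =
  IsFibonacci-≈ {P} {Q} P≈Q fib ,
  from (horizontal-exposed Q m) (trans (sym (Horizontal.exposed-≈
    (λ (u , w) (x , y) → cong (x ℤ.+ u ,_) (swap y w)) {P} {Q} P≈Q)) (to (horizontal-exposed P m) hor)) ,
  from (vertical-exposed Q n) (trans (sym (Vertical.exposed-≈
    (λ (u , w) (x , y) → cong (_, y ℤ.+ w) (swap x u)) {P} {Q} P≈Q)) (to (vertical-exposed P n) ver))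
  where
  swap : ∀ i j → i ℤ.+ j ℤ.+ -1ℤ ≡ i ℤ.+ -1ℤ ℤ.+ j
  swap = ℤ-solve-∀

-- The polyomino with given column heights

-- Junk value 0 past the end.
height : List ℕ → ℕ → ℕ
height []       _       = 0
height (h ∷ hs) zero    = h
height (h ∷ hs) (suc i) = height hs i

-- Since the next column starts one row higher, a height of at least 2 is what makes a column share
-- a row with its right neighbour.
data Valid : List ℕ → Set where
  last : ∀ {h} → 1 ≤ h → Valid (h ∷ [])
  _∷_  : ∀ {h hs} → 2 ≤ h → Valid hs → Valid (h ∷ hs)

height≤length : ∀ hs {i} → 0 < height hs i → i < length hs
height≤length (h ∷ hs) {zero}  _   = s≤s z≤n
height≤length (h ∷ hs) {suc i} 0<h = s≤s (height≤length hs 0<h)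

valid-height : ∀ {hs} → Valid hs → ∀ {i} → i < length hs → 0 < height hs i
valid-height (last 1≤h) {zero}  _         = 1≤h
valid-height (last _)   {suc i} (s≤s ())
valid-height (2≤h ∷ _)  {zero}  _         = ≤-trans (s≤s z≤n) 2≤h
valid-height (_ ∷ v)    {suc i} (s≤s i<)  = valid-height v i<

valid-height₂ : ∀ {hs} → Valid hs → ∀ {i} → suc i < length hs → 2 ≤ height hs i
valid-height₂ (last _)   {i}     (s≤s ())
valid-height₂ (2≤h ∷ _)  {zero}  _        = 2≤h
valid-height₂ (_ ∷ v)    {suc i} (s≤s i<) = valid-height₂ v i<

valid : ∀ hs → hs ≢ [] → (∀ {i} → i < length hs → 0 < height hs i) →
        (∀ {i} → suc i < length hs → 2 ≤ height hs i) → Valid hs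
valid []            ne pos two = contradiction refl ne
valid (h ∷ [])      ne pos two = last (pos (s≤s z≤n))
valid (h ∷ h′ ∷ hs) ne pos two = two (s≤s (s≤s z≤n)) ∷ valid (h′ ∷ hs) (λ ()) (pos ∘ s≤s) (two ∘ s≤s)

-- Valid heights are positive, so the junk value 0 reveals where a list ends.
height-injective : ∀ {hs hs′} → Valid hs → Valid hs′ → (∀ i → height hs i ≡ height hs′ i) → hs ≡ hs′
height-injective {hs} {hs′} v v′ = go hs hs′ (valid-height v) (valid-height v′)
  where
  go : ∀ hs hs′ → (∀ {i} → i < length hs → 0 < height hs i) → (∀ {i} → i < length hs′ → 0 < height hs′ i) →
       (∀ i → height hs i ≡ height hs′ i) → hs ≡ hs′
  go []       []         _ _  _  = refl
  go []       (h′ ∷ hs′) _ p′ eq = contradiction (eq 0) (<⇒≢ (p′ (s≤s z≤n)))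
  go (h ∷ hs) []         p _  eq = contradiction (sym (eq 0)) (<⇒≢ (p (s≤s z≤n)))
  go (h ∷ hs) (h′ ∷ hs′) p p′ eq = cong₂ _∷_ (eq 0) (go hs hs′ (p ∘ s≤s) (p′ ∘ s≤s) (eq ∘ suc))

-- The j-th cell from the bottom of column i, both counted from 0.
cell : ℕ → ℕ → Cell
cell i j = + i , + (i + j)

cell-injective : ∀ {i j i′ j′} → cell i j ≡ cell i′ j′ → i ≡ i′ × j ≡ j′
cell-injective {i} {j} {i′} {j′} eq with refl ← ℤ.+-injective (cong proj₁ eq) =
  refl , +-cancelˡ-≡ i j j′ (ℤ.+-injective (cong proj₂ eq))

columns : ℕ → List ℕ → List Cell
columns i []       = []
columns i (h ∷ hs) = applyUpTo (cell i) h ++ columns (suc i) hs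

∈-columns⁻ : ∀ i hs {c} → c ∈ columns i hs → ∃ λ d → ∃ λ j → c ≡ cell (i + d) j × j < height hs d
∈-columns⁻ i (h ∷ hs) c∈ with ∈-++⁻ (applyUpTo (cell i) h) c∈
... | inj₁ p with j , j<h , refl ← ∈-applyUpTo⁻ (cell i) p =
  0 , j , cong (λ x → cell x j) (sym (+-identityʳ i)) , j<h
... | inj₂ p with d , j , refl , j<h ← ∈-columns⁻ (suc i) hs p =
  suc d , j , cong (λ x → cell x j) (sym (+-suc i d)) , j<h

∈-columns⁺ : ∀ i hs d {j} → j < height hs d → cell (i + d) j ∈ columns i hs
∈-columns⁺ i (h ∷ hs) zero {j} j<h =
  subst (λ x → cell x j ∈ columns i (h ∷ hs)) (sym (+-identityʳ i)) (∈-++⁺ˡ (∈-applyUpTo⁺ (cell i) j<h))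
∈-columns⁺ i (h ∷ hs) (suc d) {j} j<h =
  subst (λ x → cell x j ∈ columns i (h ∷ hs)) (sym (+-suc i d))
    (∈-++⁺ʳ (applyUpTo (cell i) h) (∈-columns⁺ (suc i) hs d j<h))

columns-unique : ∀ i hs → Unique (columns i hs)
columns-unique i []       = []
columns-unique i (h ∷ hs) = Unique.++⁺
  (Unique.applyUpTo⁺₁ (cell i) h (λ j<k _ → <⇒≢ j<k ∘ proj₂ ∘ cell-injective {i} {_} {i}))
  (columns-unique (suc i) hs) disjoint
  where
  disjoint : ∀ {c} → c ∈ applyUpTo (cell i) h × c ∈ columns (suc i) hs → ⊥
  disjoint (p , q) with j , _ , refl ← ∈-applyUpTo⁻ (cell i) p
                   with d , j′ , eq , _ ← ∈-columns⁻ (suc i) hs q =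
    m≢1+m+n i (proj₁ (cell-injective {i} {j} {suc i + d} {j′} eq))

cell-∈ : ∀ {hs i j} → cell i j ∈ columns 0 hs ⇔ j < height hs i
cell-∈ {hs} {i} {j} = mk⇔ only (∈-columns⁺ 0 hs i)
  where
  only : cell i j ∈ columns 0 hs → j < height hs i
  only c∈ with i′ , j′ , eq , j<h ← ∈-columns⁻ 0 hs c∈
          with refl , refl ← cell-injective {i} {j} {i′} {j′} eq = j<h

module _ (hs : List ℕ) (v : Valid hs) where

  private
    cs : List Cell
    cs = columns 0 hs

    Step : Cell → Cell → Set
    Step a b = a ∈ cs × b ∈ cs × Adjacent a b

    Step-sym : ∀ {a b} → Step a b → Step b a
    Step-sym {x , y} {x′ , y′} (a∈ , b∈ , adj) = b∈ , a∈ ,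
      trans (cong₂ _+_ (ℤ.∣i-j∣≡∣j-i∣ x′ x) (ℤ.∣i-j∣≡∣j-i∣ y′ y)) adj

    adjacent-up : ∀ i j → Adjacent (cell i (suc j)) (cell i j)
    adjacent-up i j = cong₂ _+_ (cong ∣_∣ (ℤ.+-inverseʳ (+ i))) (cong ∣_∣ (begin
      + (i + suc j) ℤ.- + (i + j)             ≡⟨ cong (λ k → + k ℤ.- + (i + j)) (+-suc i j) ⟩
      + (1 + (i + j)) ℤ.- + (i + j)           ≡⟨ cong (ℤ._- + (i + j)) (ℤ.pos-+ 1 (i + j)) ⟩
      1ℤ ℤ.+ + (i + j) ℤ.- + (i + j)          ≡⟨ cancel (+ (i + j)) ⟩
      1ℤ ∎))
      where
      open ≡-Reasoning
      cancel : ∀ k → 1ℤ ℤ.+ k ℤ.- k ≡ 1ℤ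
      cancel = ℤ-solve-∀

    adjacent-left : ∀ i → Adjacent (cell (suc i) 0) (cell i 1)
    adjacent-left i = cong₂ _+_ (cong ∣_∣ (begin
      + (1 + i) ℤ.- + i         ≡⟨ cong (ℤ._- + i) (ℤ.pos-+ 1 i) ⟩
      1ℤ ℤ.+ + i ℤ.- + i        ≡⟨ cancel (+ i) ⟩
      1ℤ ∎)) (cong ∣_∣ (trans (cong (λ k → + k ℤ.- + (i + 1)) (sym (+-suc i 0))) (ℤ.+-inverseʳ (+ (i + 1)))))
      where
      open ≡-Reasoning
      cancel : ∀ k → 1ℤ ℤ.+ k ℤ.- k ≡ 1ℤ
      cancel = ℤ-solve-∀

    toBottom : ∀ i j → j < height hs i → Star Step (cell i j) (cell i 0)
    toBottom i zero    _   = ε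
    toBottom i (suc j) j<h =
      (∈-columns⁺ 0 hs i j<h , ∈-columns⁺ 0 hs i (<⇒≤ j<h) , adjacent-up i j) ◅ toBottom i j (<⇒≤ j<h)

    -- The bottom of column i + 1 lies in the same row as the second cell of column i, which exists
    -- because that column has height at least 2. From there the path descends and repeats.
    toOrigin : ∀ i → 0 < height hs i → Star Step (cell i 0) (cell 0 0)
    toOrigin zero    _   = ε
    toOrigin (suc i) 0<h =
      (∈-columns⁺ 0 hs (suc i) 0<h , ∈-columns⁺ 0 hs i 2≤h , adjacent-left i)
      ◅ toBottom i 1 2≤h ◅◅ toOrigin i (<⇒≤ 2≤h)
      where
      2≤h : 2 ≤ height hs i
      2≤h = valid-height₂ v (height≤length hs 0<h)

    path : ∀ {c} → c ∈ cs → Star Step c (cell 0 0)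
    path c∈ with i , j , refl , j<h ← ∈-columns⁻ 0 hs c∈ =
      toBottom i j j<h ◅◅ toOrigin i (≤-trans (s≤s z≤n) j<h)

    valid-nonempty : ∀ {hs} → Valid hs → 0 < length hs
    valid-nonempty (last _) = s≤s z≤n
    valid-nonempty (_ ∷ _)  = s≤s z≤n

  0<length : 0 < length hs
  0<length = valid-nonempty v

  origin∈ : cell 0 0 ∈ columns 0 hs
  origin∈ = ∈-columns⁺ 0 hs 0 (valid-height v 0<length)

  polyomino : Polyomino
  polyomino = record
    { cells     = columns 0 hs
    ; unique    = columns-unique 0 hs
    ; nonempty  = λ eq → contradiction (subst (cell 0 0 ∈_) eq origin∈) (λ ())
    ; connected = λ c∈ d∈ → path c∈ ◅◅ reverse Step-sym (path d∈)
    }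

  polyomino-isFibonacci : IsFibonacci polyomino
  polyomino-isFibonacci = convex , rising
    where
    convex : ColumnConvex polyomino
    convex p q y₁≤y y≤y₂ with i , j₁ , refl , _ ← ∈-columns⁻ 0 hs p
                         with i , j₂ , refl , j₂<h ← ∈-columns⁻ 0 hs q
                         with ℤ.+≤+ {n = y} j₁≤y ← y₁≤y | ℤ.+≤+ y≤j₂ ← y≤y₂
                         with j , refl ← m≤n⇒∃[o]m+o≡n (≤-trans (m≤m+n i j₁) j₁≤y) =
      ∈-columns⁺ 0 hs i (≤-<-trans (+-cancelˡ-≤ i j j₂ y≤j₂) j₂<h)

    bottom : ∀ {x y} → IsBottom polyomino (x , y) → ∃ λ i → x ≡ + i × y ≡ + i
    bottom (c∈ , low) with i , j , refl , j<h ← ∈-columns⁻ 0 hs c∈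
                      with ℤ.+≤+ i+j≤i ← low (+ (i + 0)) (∈-columns⁺ 0 hs i (≤-trans (s≤s z≤n) j<h)) =
      i , refl , cong +_ (≤-antisym (subst (i + j ≤_) (+-identityʳ i) i+j≤i) (m≤m+n i j))

    rising : BottomsRiseByOne polyomino
    rising p q with i , refl , refl ← bottom p
               with i′ , eq , refl ← bottom q = sym eq

  -- The cells with nothing beneath them are the column bottoms, one per column.
  length-horizontal-exposed : length (Horizontal.exposed (columns 0 hs)) ≡ length hs
  length-horizontal-exposed = sym (trans (sym (length-upTo (length hs)))
    (length-bijection (λ i → cell i 0) (proj₁ ∘ cell-injective) (Unique.upTo⁺ (length hs))
      (Unique.filter⁺ _ (columns-unique 0 hs)) into onto))
    where
    exposed? : Decidable (λ c → ¬ (up⁻¹ c ∈ cs))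
    exposed? c = ¬? (up⁻¹ c ∈? cs)

    under : ∀ i → up⁻¹ (cell i 0) ∉ cs
    under zero p with _ , _ , () , _ ← ∈-columns⁻ 0 hs p
    under (suc i) p with i′ , j , eq , _ ← ∈-columns⁻ 0 hs p with refl ← ℤ.+-injective (cong proj₁ eq) =
      m≢1+m+n (i + 0) (trans (ℤ.+-injective (cong proj₂ eq)) (cong suc (cong (_+ j) (sym (+-identityʳ i)))))

    into : ∀ {i} → i ∈ upTo (length hs) → cell i 0 ∈ filter exposed? cs
    into {i} i∈ = ∈-filter⁺ exposed? (∈-columns⁺ 0 hs i (valid-height v (∈-upTo⁻ i∈))) (under i)

    onto : ∀ {c} → c ∈ filter exposed? cs → ∃ λ i → i ∈ upTo (length hs) × c ≡ cell i 0
    onto c∈ with c∈cs , exp ← ∈-filter⁻ exposed? {xs = cs} c∈ with ∈-columns⁻ 0 hs c∈cs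
    ... | i , zero  , refl , 0<h = i , ∈-upTo⁺ (height≤length hs 0<h) , refl
    ... | i , suc j , refl , j<h = contradiction
      (subst (_∈ cs) (cong (λ k → + i , + k ℤ.+ -1ℤ) (sym (+-suc i j))) (∈-columns⁺ 0 hs i (<⇒≤ j<h))) exp

-- Here `g` is the height of the preceding column, and `h ∸ pred g` is (h + 1 - g)⁺ for g ≥ 1. The
-- value 0 stands for no preceding column: as `pred 0` is 0, the full height is then charged.
rise : ℕ → List ℕ → ℕ
rise g []       = 0
rise g (h ∷ hs) = (h ∸ pred g) + rise h hs

length-filter-applyUpTo : {A : Set} {P : A → Set} (P? : Decidable P) (f : ℕ → A) (h b : ℕ) →
                          (∀ j → P (f j) ⇔ b ≤ j) → length (filter P? (applyUpTo f h)) ≡ h ∸ b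
length-filter-applyUpTo P? f zero    b       P⇔ = sym (0∸n≡0 b)
length-filter-applyUpTo P? f (suc h) zero    P⇔ =
  trans (cong length (filter-accept P? (from (P⇔ 0) z≤n)))
    (cong suc (length-filter-applyUpTo P? (f ∘ suc) h 0 (λ j → mk⇔ (λ _ → z≤n) (λ _ → from (P⇔ (suc j)) z≤n))))
length-filter-applyUpTo P? f (suc h) (suc b) P⇔ =
  trans (cong length (filter-reject P? (λ p → contradiction (to (P⇔ 0) p) (λ ()))))
    (length-filter-applyUpTo P? (f ∘ suc) h b
      (λ j → mk⇔ (≤-pred ∘ to (P⇔ (suc j))) (from (P⇔ (suc j)) ∘ s≤s)))

-- In each column `P` fails exactly at indices below `pred` of the preceding height, so truncated
-- subtraction counts the remaining cells.
length-filter-columns : {P : Cell → Set} (P? : Decidable P) (i g : ℕ) (hs : List ℕ) →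
                        (∀ d j → P (cell (i + d) j) ⇔ height (g ∷ hs) d ≤ suc j) →
                        length (filter P? (columns i hs)) ≡ rise g hs
length-filter-columns P? i g []       P⇔ = refl
length-filter-columns {P} P? i g (h ∷ hs) P⇔ = begin
  length (filter P? (applyUpTo (cell i) h ++ columns (suc i) hs))
    ≡⟨ cong length (filter-++ P? (applyUpTo (cell i) h) (columns (suc i) hs)) ⟩
  length (filter P? (applyUpTo (cell i) h) ++ filter P? (columns (suc i) hs))
    ≡⟨ length-++ (filter P? (applyUpTo (cell i) h)) ⟩
  length (filter P? (applyUpTo (cell i) h)) + length (filter P? (columns (suc i) hs))
    ≡⟨ cong₂ _+_
         (length-filter-applyUpTo P? (cell i) h (pred g) (λ j → mk⇔
           (λ p → pred-mono-≤ (to (P⇔ 0 j) (subst (λ k → P (cell k j)) (sym (+-identityʳ i)) p)))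
           (λ b≤j → subst (λ k → P (cell k j)) (+-identityʳ i) (from (P⇔ 0 j) (≤-trans (suc-pred-≤ g) (s≤s b≤j))))))
         (length-filter-columns P? (suc i) h hs (λ d j →
           subst (λ k → P (cell k j) ⇔ height (h ∷ hs) d ≤ suc j) (+-suc i d) (P⇔ (suc d) j))) ⟩
  (h ∸ pred g) + rise h hs ∎
  where
  open ≡-Reasoning
  suc-pred-≤ : ∀ g → g ≤ suc (pred g)
  suc-pred-≤ zero    = z≤n
  suc-pred-≤ (suc g) = ≤-refl

-- Bottoms rise by one, so the left neighbour of the cell with index j has index j + 1 in its own
-- column. It is missing exactly when the preceding height is at most j + 1; a virtual height 0
-- handles the first column.
length-vertical-exposed : ∀ hs → length (Vertical.exposed (columns 0 hs)) ≡ rise 0 hs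
length-vertical-exposed hs = length-filter-columns (λ c → ¬? (right⁻¹ c ∈? columns 0 hs)) 0 0 hs exposed⇔
  where
  exposed⇔ : ∀ d j → (¬ (right⁻¹ (cell d j) ∈ columns 0 hs)) ⇔ height (0 ∷ hs) d ≤ suc j
  exposed⇔ zero    j = mk⇔ (λ _ → z≤n) (λ _ → outside)
    where
    outside : right⁻¹ (cell 0 j) ∉ columns 0 hs
    outside p with _ , _ , () , _ ← ∈-columns⁻ 0 hs p
  exposed⇔ (suc d) j = mk⇔
    (λ ∉ → ≮⇒≥ (∉ ∘ subst (_∈ columns 0 hs) neighbour ∘ ∈-columns⁺ 0 hs d))
    (λ h≤ p → <⇒≱ (to (cell-∈ {hs} {d} {suc j}) (subst (_∈ columns 0 hs) (sym neighbour) p)) h≤)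
    where
    neighbour : cell d (suc j) ≡ right⁻¹ (cell (suc d) j)
    neighbour = cong (λ k → + d , + k) (+-suc d j)

FibonacciOfSize-polyomino : ∀ {m n} hs (v : Valid hs) →
  FibonacciOfSize m n (polyomino hs v) ⇔ (length hs ≡ m × rise 0 hs ≡ n)
FibonacciOfSize-polyomino {m} {n} hs v = mk⇔
  (λ (_ , hor , ver) →
    trans (sym (length-horizontal-exposed hs v)) (to (horizontal-exposed (polyomino hs v) m) hor) ,
    trans (sym (length-vertical-exposed hs)) (to (vertical-exposed (polyomino hs v) n) ver))
  (λ (len , ris) → polyomino-isFibonacci hs v ,
    from (horizontal-exposed (polyomino hs v) m) (trans (length-horizontal-exposed hs v) len) ,
    from (vertical-exposed (polyomino hs v) n) (trans (length-vertical-exposed hs) ris))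

finalHeight : List ℕ → ℕ
finalHeight hs = height hs (pred (length hs))

columnHeight-polyomino : ∀ hs (v : Valid hs) i → columnHeight (polyomino hs v) (+ i) ≡ height hs i
columnHeight-polyomino hs v i = sym (trans (sym (length-upTo (height hs i)))
  (length-bijection (cell i) (proj₂ ∘ cell-injective {i} {_} {i}) (Unique.upTo⁺ (height hs i))
    (Unique.filter⁺ _ (columns-unique 0 hs))
    (λ j∈ → ∈-filter⁺ in-column? (∈-columns⁺ 0 hs i (∈-upTo⁻ j∈)) refl) onto))
  where
  in-column? : Decidable (λ (c : Cell) → proj₁ c ≡ + i)
  in-column? c = proj₁ c ℤ.≟ + i

  onto : ∀ {c} → c ∈ filter in-column? (columns 0 hs) → ∃ λ j → j ∈ upTo (height hs i) × c ≡ cell i j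
  onto c∈ with c∈cs , eq ← ∈-filter⁻ in-column? {xs = columns 0 hs} c∈
          with i′ , j , refl , j<h ← ∈-columns⁻ 0 hs c∈cs
          with refl ← ℤ.+-injective eq = j , ∈-upTo⁺ j<h , refl

LastColumnHeight-polyomino : ∀ {H} hs (v : Valid hs) →
  LastColumnHeight H (polyomino hs v) ⇔ H (finalHeight hs)
LastColumnHeight-polyomino {H} hs v = mk⇔ forward backward
  where
  final : ℕ
  final = pred (length hs)

  suc-final : suc final ≡ length hs
  suc-final = suc-pred (length hs) ⦃ >-nonZero (0<length hs v) ⦄

  0<h : 0 < height hs final
  0<h = valid-height v (≤-reflexive suc-final)

  before : ∀ {i j} → j < height hs i → i ≤ final
  before j<h = ≤-pred (≤-trans (height≤length hs (≤-trans (s≤s z≤n) j<h)) (≤-reflexive (sym suc-final)))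

  forward : LastColumnHeight H (polyomino hs v) → H (finalHeight hs)
  forward (x , ((y , c∈) , rightmost) , h) with i , j , refl , j<h ← ∈-columns⁻ 0 hs c∈
    with ℤ.+≤+ final≤i ← rightmost (∈-columns⁺ 0 hs final 0<h)
    with refl ← ≤-antisym final≤i (before {i} j<h) = subst H (columnHeight-polyomino hs v final) h

  backward : H (finalHeight hs) → LastColumnHeight H (polyomino hs v)
  backward h = + final , ((+ (final + 0) , ∈-columns⁺ 0 hs final 0<h) , rightmost) ,
    subst H (sym (columnHeight-polyomino hs v final)) h
    where
    rightmost : ∀ {c} → c ∈ columns 0 hs → proj₁ c ℤ.≤ + final
    rightmost c∈ with i , j , refl , j<h ← ∈-columns⁻ 0 hs c∈ = ℤ.+≤+ (before {i} j<h)

-- Both figures contain the origin and lie in the quadrant of nonnegative coordinates. The image of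
-- one origin and the preimage of the other force the translation to be zero, and heights are then
-- read off from membership.
polyomino-injective : ∀ {hs hs′} (v : Valid hs) (v′ : Valid hs′) → polyomino hs v ≈ polyomino hs′ v′ → hs ≡ hs′
polyomino-injective {hs} {hs′} v v′ ((u , w) , f) = height-injective v v′ heights
  where
  forth : ∀ {hs} → (u , w) ∈ columns 0 hs → 0ℤ ℤ.≤ u × 0ℤ ℤ.≤ w
  forth {hs} p with i , j , refl , _ ← ∈-columns⁻ 0 hs p = ℤ.+≤+ z≤n , ℤ.+≤+ z≤n

  back : ∀ {u w} → (ℤ.- u , ℤ.- w) ∈ columns 0 hs → 0ℤ ℤ.≤ u × 0ℤ ℤ.≤ w → (u , w) ≡ (0ℤ , 0ℤ)
  back {+ zero}  {+ zero}  p _ = refl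
  back {+ suc u} {_}       p _ with _ , _ , () , _ ← ∈-columns⁻ 0 hs p
  back {+ zero}  {+ suc w} p _ with _ , _ , () , _ ← ∈-columns⁻ 0 hs p
  back {+ zero}  { -[1+ _ ] } p (_ , ())
  back { -[1+ _ ] } p (() , _)

  shift≡0 : (u , w) ≡ (0ℤ , 0ℤ)
  shift≡0 = back
    (from (f _) (subst (_∈ columns 0 hs′) (sym (cong₂ _,_ (ℤ.+-inverseˡ u) (ℤ.+-inverseˡ w))) (origin∈ hs′ v′)))
    (forth {hs′} (subst (_∈ columns 0 hs′) (cong₂ _,_ (ℤ.+-identityˡ u) (ℤ.+-identityˡ w)) (to (f _) (origin∈ hs v))))

  same : ∀ i j → translate (u , w) (cell i j) ≡ cell i j
  same i j = trans (cong (λ s → translate s (cell i j)) shift≡0)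
    (cong₂ _,_ (ℤ.+-identityʳ (+ i)) (ℤ.+-identityʳ (+ (i + j))))

  <⇔ : ∀ i j → j < height hs i ⇔ j < height hs′ i
  <⇔ i j = mk⇔
    (λ p → to (cell-∈ {hs′} {i} {j}) (subst (_∈ columns 0 hs′) (same i j) (to (f _) (∈-columns⁺ 0 hs i p))))
    (λ p → to (cell-∈ {hs} {i} {j}) (from (f _) (subst (_∈ columns 0 hs′) (sym (same i j)) (∈-columns⁺ 0 hs′ i p))))

  heights : ∀ i → height hs i ≡ height hs′ i
  heights i = ≤-antisym (≮⇒≥ (λ p → n≮n _ (to (<⇔ i _) p))) (≮⇒≥ (λ p → n≮n _ (from (<⇔ i _) p)))

-- Column heights of a Fibonacci polyomino

minimum : {A : Set} (f : A → ℤ) (xs : List A) → xs ≢ [] → ∃ λ x → x ∈ xs × (∀ {y} → y ∈ xs → f x ℤ.≤ f y)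
minimum f []           ne = contradiction refl ne
minimum f (x ∷ [])     ne = x , here refl , λ { (here refl) → ℤ.≤-refl }
minimum f (x ∷ y ∷ xs) ne with z , z∈ , least ← minimum f (y ∷ xs) (λ ()) with ℤ.≤-total (f x) (f z)
... | inj₁ fx≤fz = x , here refl , λ { (here refl) → ℤ.≤-refl ; (there p) → ℤ.≤-trans fx≤fz (least p) }
... | inj₂ fz≤fx = z , there z∈ , λ { (here refl) → fz≤fx ; (there p) → least p }

≤⇒∃ : ∀ {i j} → i ℤ.≤ j → ∃ λ n → j ≡ i ℤ.+ + n
≤⇒∃ {i} {j} i≤j = ∣ j ℤ.- i ∣ ,
  trans (split i j) (cong (λ k → i ℤ.+ k) (sym (ℤ.0≤i⇒+∣i∣≡i (ℤ.i≤j⇒0≤j-i i≤j))))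
  where
  split : ∀ i j → j ≡ i ℤ.+ (j ℤ.- i)
  split = ℤ-solve-∀

+pos-cancel-≤ : ∀ i {m n} → i ℤ.+ + m ℤ.≤ i ℤ.+ + n → m ≤ n
+pos-cancel-≤ i {m} {n} p =
  ℤ.drop‿+≤+ (subst₂ ℤ._≤_ (cancel i (+ m)) (cancel i (+ n)) (ℤ.+-monoʳ-≤ (ℤ.- i) p))
  where
  cancel : ∀ i j → ℤ.- i ℤ.+ (i ℤ.+ j) ≡ j
  cancel = ℤ-solve-∀

-- A discrete intermediate value argument: a path that passes from columns up to `x` to columns
-- beyond it makes a step from `x` to `x + 1`, and that step stays in its row.
crossing : ∀ (cs : List Cell) {c d} → Star (λ a b → a ∈ cs × b ∈ cs × Adjacent a b) c d →
           ∀ {x} → proj₁ c ℤ.≤ x → x ℤ.< proj₁ d → ∃ λ y → (x , y) ∈ cs × (x ℤ.+ 1ℤ , y) ∈ cs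
crossing cs ε c≤x x<c = contradiction x<c (ℤ.≤⇒≯ c≤x)
crossing cs {a , b} (_◅_ {j = a′ , b′} (c∈ , c′∈ , adj) path) {x} a≤x x<d with a′ ℤ.≤? x
... | yes a′≤x = crossing cs path a′≤x x<d
-- `p` and `q` measure the overshoot on either side: x = a + p and a′ = x + 1 + q. The step has
-- length 1, so both vanish and the row is unchanged.
... | no  a′≰x with p , refl ← ≤⇒∃ a≤x
               with q , refl ← ≤⇒∃ (ℤ.i<j⇒suc[i]≤j (ℤ.≰⇒> a′≰x)) =
  b , subst (λ k → (k , b) ∈ cs) (trans (sym (ℤ.+-identityʳ a)) (cong (λ k → a ℤ.+ + k) (sym p≡0))) c∈ ,
  subst₂ (λ k l → (k , l) ∈ cs) column row c′∈
  where
  gap : ∣ a ℤ.- (1ℤ ℤ.+ (a ℤ.+ + p) ℤ.+ + q) ∣ ≡ suc (p + q)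
  gap = trans (ℤ.∣i-j∣≡∣j-i∣ a _) (cong ∣_∣ (identity a (+ p) (+ q)))
    where
    identity : ∀ a p q → 1ℤ ℤ.+ (a ℤ.+ p) ℤ.+ q ℤ.- a ≡ 1ℤ ℤ.+ (p ℤ.+ q)
    identity = ℤ-solve-∀
  total : (p + q) + ∣ b ℤ.- b′ ∣ ≡ 0
  total = suc-injective (trans (cong (_+ ∣ b ℤ.- b′ ∣) (sym gap)) adj)
  p≡0 : p ≡ 0
  p≡0 = m+n≡0⇒m≡0 p (m+n≡0⇒m≡0 (p + q) total)
  q≡0 : q ≡ 0
  q≡0 = m+n≡0⇒n≡0 p (m+n≡0⇒m≡0 (p + q) total)
  column : 1ℤ ℤ.+ (a ℤ.+ + p) ℤ.+ + q ≡ a ℤ.+ + p ℤ.+ 1ℤ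
  column = trans (cong (λ k → 1ℤ ℤ.+ (a ℤ.+ + p) ℤ.+ + k) q≡0) (identity (a ℤ.+ + p))
    where
    identity : ∀ i → 1ℤ ℤ.+ i ℤ.+ 0ℤ ≡ i ℤ.+ 1ℤ
    identity = ℤ-solve-∀
  row : b′ ≡ b
  row = sym (ℤ.i-j≡0⇒i≡j b b′ (ℤ.∣i∣≡0⇒i≡0 (m+n≡0⇒n≡0 (p + q) total)))

choose : (R : ℕ → ℕ → Set) (n : ℕ) → (∀ i → i < n → ∃ (R i)) →
         ∃ λ hs → length hs ≡ n × (∀ i → i < n → R i (height hs i))
choose R zero    r = [] , refl , λ _ ()
choose R (suc n) r with h , Rh ← r 0 (s≤s z≤n)
                   with hs , len , Rhs ← choose (R ∘ suc) n (λ i i<n → r (suc i) (s≤s i<n)) =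
  h ∷ hs , cong suc len , λ { zero _ → Rh ; (suc i) (s≤s i<n) → Rhs i i<n }

module _ (P : Polyomino) where

  private
    inColumn : ℤ → List Cell
    inColumn x = filter (λ c → proj₁ c ℤ.≟ x) (cells P)

    ∈-inColumn : ∀ {x y} → (x , y) ∈ cells P → (x , y) ∈ inColumn x
    ∈-inColumn {x} c∈ = ∈-filter⁺ (λ c → proj₁ c ℤ.≟ x) c∈ refl

    -- With `f` the identity this finds the bottom of the column, with `f` negation its top.
    extremal : ∀ {x y} (f : ℤ → ℤ) → (x , y) ∈ cells P →
               ∃ λ b → (x , b) ∈ cells P × (∀ y′ → (x , y′) ∈ cells P → f b ℤ.≤ f y′)
    extremal {x} {y} f c∈
      with (x′ , b) , b∈ , least ← minimum (f ∘ proj₂) (inColumn x)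
             (λ eq → contradiction (subst ((x , y) ∈_) eq (∈-inColumn c∈)) (λ ()))
      with b∈P , refl ← ∈-filter⁻ (λ c → proj₁ c ℤ.≟ x) {xs = cells P} b∈ =
      b , b∈P , λ y′ c′∈ → least (∈-inColumn c′∈)

  -- The set of cells is described relative to the bottom (x₀ , b₀) of the first column;
  -- w + 1 is the number of columns.
  module FromCorner
    (convex : ColumnConvex P) (rising : BottomsRiseByOne P) (x₀ b₀ : ℤ) (w : ℕ)
    (leftmost : ∀ {c} → c ∈ cells P → x₀ ℤ.≤ proj₁ c)
    (rightmost : ∀ {c} → c ∈ cells P → proj₁ c ℤ.≤ x₀ ℤ.+ + w)
    (b₀-bottom : IsBottom P (x₀ , b₀))
    (crossing-at : ∀ {i} → i < w → ∃ λ y → (x₀ ℤ.+ + i , y) ∈ cells P × (x₀ ℤ.+ + i ℤ.+ 1ℤ , y) ∈ cells P)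
    where

    at : ℕ → ℕ → Cell
    at i j = x₀ ℤ.+ + i , b₀ ℤ.+ + (i + j)

    shift : ∀ x i → x ℤ.+ + i ℤ.+ 1ℤ ≡ x ℤ.+ + suc i
    shift x i = trans (ℤ.+-assoc x (+ i) 1ℤ) (cong (λ k → x ℤ.+ + k) (+-comm i 1))

    -- The crossing from column `i` shows that column i + 1 is nonempty; it therefore has a bottom,
    -- to which `rising` applies.
    bottoms : ∀ i → i ≤ w → IsBottom P (at i 0)
    bottoms zero    _   = subst₂ (λ x y → IsBottom P (x , y)) (sym (ℤ.+-identityʳ x₀)) (sym (ℤ.+-identityʳ b₀)) b₀-bottom
    bottoms (suc i) i<w with y , _ , c∈ ← crossing-at i<w
                        with b , bottom ← extremal (λ y → y) c∈ =
      subst₂ (λ x y → IsBottom P (x , y)) (shift x₀ i)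
        (trans (rising (bottoms i (<⇒≤ i<w)) bottom) (shift b₀ (i + 0))) bottom

    climb-from : ∀ i j → b₀ ℤ.+ + (i + 0) ℤ.+ + j ≡ b₀ ℤ.+ + (i + j)
    climb-from i j = trans (ℤ.+-assoc b₀ (+ (i + 0)) (+ j)) (cong (λ k → b₀ ℤ.+ + (k + j)) (+-identityʳ i))

    Column : ℕ → ℕ → Set
    Column i h = 0 < h × (i < w → 2 ≤ h) × (∀ j → at i j ∈ cells P ⇔ j < h)

    column : ∀ i → i < suc w → ∃ (Column i)
    column i (s≤s i≤w)
      with bottom∈ , lowest ← bottoms i i≤w
      with t , t∈ , highest ← extremal ℤ.-_ bottom∈
      with k , refl ← ≤⇒∃ (lowest t t∈) = suc k , s≤s z≤n , two , λ j → mk⇔ (s≤s ∘ bounded j) (inside j ∘ ≤-pred)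
      where
      bounded : ∀ j → at i j ∈ cells P → j ≤ k
      bounded j c∈ = +-cancelˡ-≤ i j k (+pos-cancel-≤ b₀
        (subst (b₀ ℤ.+ + (i + j) ℤ.≤_) (climb-from i k) (ℤ.neg-cancel-≤ (highest _ c∈))))

      inside : ∀ j → j ≤ k → at i j ∈ cells P
      inside j j≤k = convex bottom∈ t∈
        (ℤ.+-monoʳ-≤ b₀ (ℤ.+≤+ (+-monoʳ-≤ i z≤n)))
        (subst (b₀ ℤ.+ + (i + j) ℤ.≤_) (sym (climb-from i k)) (ℤ.+-monoʳ-≤ b₀ (ℤ.+≤+ (+-monoʳ-≤ i j≤k))))

      -- The crossing row is at or above the bottom of column i + 1, hence strictly above that of
      -- column i, which thus has a second cell.
      two : i < w → 2 ≤ suc k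
      two i<w with y , c∈ , c′∈ ← crossing-at i<w
              with n , refl ← ≤⇒∃ (proj₂ (bottoms (suc i) i<w) y (subst (λ x → (x , y) ∈ cells P) (shift x₀ i) c′∈)) =
        s≤s (≤-trans (s≤s z≤n) (bounded (suc n) (subst (λ y → (x₀ ℤ.+ + i , y) ∈ cells P)
          (trans (climb-from (suc i) n) (cong (λ k → b₀ ℤ.+ + k) (sym (+-suc i n)))) c∈)))

    cover : ∀ {c} → c ∈ cells P → ∃ λ i → ∃ λ j → i ≤ w × c ≡ at i j
    cover {x , y} c∈ with i , refl ← ≤⇒∃ (leftmost c∈) =
      let i≤w = +pos-cancel-≤ x₀ (rightmost c∈)
          j , eq = ≤⇒∃ (proj₂ (bottoms i i≤w) y c∈)
      in i , j , i≤w , cong (x₀ ℤ.+ + i ,_) (trans eq (climb-from i j))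

    at-cell : ∀ i j → translate (ℤ.- x₀ , ℤ.- b₀) (at i j) ≡ cell i j
    at-cell i j = cong₂ _,_ (cancel x₀ (+ i)) (cancel b₀ (+ (i + j)))
      where
      cancel : ∀ i j → i ℤ.+ j ℤ.- i ≡ j
      cancel = ℤ-solve-∀

    module _ (hs : List ℕ) (len : length hs ≡ suc w) (cols : ∀ i → i < suc w → Column i (height hs i)) where

      heights-valid : Valid hs
      heights-valid = valid hs hs≢[] positive two
        where
        hs≢[] : hs ≢ []
        hs≢[] eq = contradiction (trans (sym len) (cong length eq)) (λ ())
        positive : ∀ {i} → i < length hs → 0 < height hs i
        positive {i} i< = proj₁ (cols i (subst (i <_) len i<))
        two : ∀ {i} → suc i < length hs → 2 ≤ height hs i
        two {i} i< = proj₁ (proj₂ (cols i (<⇒≤ i<w))) (≤-pred i<w)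
          where
          i<w : suc i < suc w
          i<w = subst (suc i <_) len i<

      forth : ∀ {c} → c ∈ cells P → translate (ℤ.- x₀ , ℤ.- b₀) c ∈ columns 0 hs
      forth {c} c∈ = let i , j , i≤w , eq = cover c∈ in
        subst (_∈ columns 0 hs) (sym (trans (cong (translate (ℤ.- x₀ , ℤ.- b₀)) eq) (at-cell i j)))
          (∈-columns⁺ 0 hs i (to (proj₂ (proj₂ (cols i (s≤s i≤w))) j) (subst (_∈ cells P) eq c∈)))

      back : ∀ c → translate (ℤ.- x₀ , ℤ.- b₀) c ∈ columns 0 hs → c ∈ cells P
      back c d∈ = let i , j , eq , j<h = ∈-columns⁻ 0 hs d∈ in
        subst (_∈ cells P) (sym (translate-injective (ℤ.- x₀ , ℤ.- b₀) {c} {at i j} (trans eq (sym (at-cell i j)))))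
          (from (proj₂ (proj₂ (cols i (subst (i <_) len (height≤length hs (≤-trans (s≤s z≤n) j<h))))) j) j<h)

    heights : ∃ λ hs → ∃ λ (v : Valid hs) → P ≈ polyomino hs v
    heights = let hs , len , cols = choose Column (suc w) column in
      hs , heights-valid hs len cols , (ℤ.- x₀ , ℤ.- b₀) , λ c → mk⇔ (forth hs len cols) (back hs len cols c)

  -- The bottom of the leftmost column is moved to the origin. Minimising the negated abscissa finds
  -- the rightmost column, and a path joining the two extreme columns crosses every gap between
  -- them.
  fibonacci-heights : IsFibonacci P → ∃ λ hs → ∃ λ (v : Valid hs) → P ≈ polyomino hs v
  fibonacci-heights (convex , rising)
    with (x₀ , y₀) , c₀∈ , leftmost ← minimum proj₁ (cells P) (nonempty P)
    with (x₁ , y₁) , c₁∈ , rightmost ← minimum (ℤ.-_ ∘ proj₁) (cells P) (nonempty P)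
    with b₀ , b₀-bottom ← extremal (λ y → y) c₀∈
    with w , refl ← ≤⇒∃ (leftmost c₁∈) =
    FromCorner.heights convex rising x₀ b₀ w leftmost (ℤ.neg-cancel-≤ ∘ rightmost) b₀-bottom
      (λ {i} i<w → crossing (cells P) (connected P c₀∈ c₁∈) (ℤ.i≤i+j x₀ (+ i)) (ℤ.+-monoʳ-< x₀ (ℤ.+<+ i<w)))

-- Counting up to translation

≈-sym : ∀ {P Q} → P ≈ Q → Q ≈ P
≈-sym {P} {Q} = IsEquivalence.sym ≈-isEquivalence {P} {Q}

≈-trans : ∀ {P Q R} → P ≈ Q → Q ≈ R → P ≈ R
≈-trans {P} {Q} {R} = IsEquivalence.trans ≈-isEquivalence {P} {Q} {R}

-- The polyominoes built from `L` represent each class once: a class is sent to the position of its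
-- height sequence, and `polyomino-injective` makes this independent of the representative.
numberOf : (Q : Polyomino → Set) → (∀ {P P′} → P ≈ P′ → Q P → Q P′) → (∀ {P} → Q P → IsFibonacci P) →
           (L : List (List ℕ)) → Unique L → (∀ {hs} → hs ∈ L → ∃ λ (v : Valid hs) → Q (polyomino hs v)) →
           (∀ {hs} (v : Valid hs) → Q (polyomino hs v) → hs ∈ L) →
           NumberOf Q (length L)
numberOf Q Q-≈ Q-fib L unique-L sound complete = record
  { to        = encode
  ; from      = decode
  ; to-cong   = λ {x} {y} → encode-cong x y
  ; from-cong = λ { {i} refl → IsEquivalence.refl ≈-isEquivalence {proj₁ (decode i)} }
  ; inverse   = (λ {i} {x} x≈ → lookup-injective unique-L (polyomino-injective
                  (proj₁ (sound (∈-lookup (encode x)))) (proj₁ (sound (∈-lookup i)))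
                  (≈-trans {proj₁ (decode (encode x))} {proj₁ x} {proj₁ (decode i)} (decode-encode x) x≈)))
              , (λ { {x} refl → decode-encode x })
  }
  where
  heights : (x : ∃ Q) → ∃ λ hs → ∃ λ (v : Valid hs) → proj₁ x ≈ polyomino hs v
  heights (P , q) = fibonacci-heights P (Q-fib q)

  heights∈ : (x : ∃ Q) → proj₁ (heights x) ∈ L
  heights∈ x@(P , q) = let hs , v , P≈ = heights x in complete v (Q-≈ {P} {polyomino hs v} P≈ q)

  encode : ∃ Q → Fin (length L)
  encode x = Any.index (heights∈ x)

  decode : Fin (length L) → ∃ Q
  decode i = polyomino (lookup L i) (proj₁ (sound (∈-lookup i))) , proj₂ (sound (∈-lookup i))

  decode-encode : ∀ x → proj₁ (decode (encode x)) ≈ proj₁ x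
  -- The two validity proofs may differ, but `_≈_` sees only the cells, so it suffices to transport
  -- along the equality of height lists.
  decode-encode x@(P , q) = ≈-sym {P} {proj₁ (decode (encode x))} (subst
    (λ hs → ∃ λ s → ∀ c → (c ∈ cells P) ⇔ (translate s c ∈ columns 0 hs))
    (lookup-index (heights∈ x)) (proj₂ (proj₂ (heights x))))

  encode-cong : ∀ x y → proj₁ x ≈ proj₁ y → encode x ≡ encode y
  encode-cong x y x≈y = lookup-injective unique-L (polyomino-injective
    (proj₁ (sound (∈-lookup (encode x)))) (proj₁ (sound (∈-lookup (encode y))))
    (≈-trans {proj₁ (decode (encode x))} {proj₁ x} {proj₁ (decode (encode y))} (decode-encode x)
      (≈-trans {proj₁ x} {proj₁ y} {proj₁ (decode (encode y))} x≈y
        (≈-sym {proj₁ (decode (encode y))} {proj₁ y} (decode-encode y)))))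

-- Height sequences encoded by climbs

raise : List ℕ → List ℕ → List ℕ
raise e ks = map (λ k → suc (suc k)) ks ++ e

raise-injective : ∀ e {ks ks′} → raise e ks ≡ raise e ks′ → ks ≡ ks′
raise-injective e eq = map-injective (suc-injective ∘ suc-injective) (++-cancelʳ e _ _ eq)

length-raise : ∀ e ks → length (raise e ks) ≡ length ks + length e
length-raise e []       = refl
length-raise e (k ∷ ks) = cong suc (length-raise e ks)

-- For heights k + 2 and k′ + 2 the charge (2 + k′) ∸ (1 + k) reduces to suc k′ ∸ k, the increment
-- in `climb`. The assumption on `e` says that the appended columns are free, as for no column or
-- one of height 1.
rise-raise : ∀ {e} → (∀ k → rise (2 + k) e ≡ 0) → ∀ k ks → rise (2 + k) (raise e ks) ≡ climb k ks
rise-raise flat k []        = flat k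
rise-raise flat k (k′ ∷ ks) = cong (λ r → suc k′ ∸ k + r) (rise-raise flat k′ ks)

short-flat : ∀ k → rise (2 + k) (1 ∷ []) ≡ 0
short-flat k = trans (+-identityʳ (0 ∸ k)) (0∸n≡0 k)

raise-tall-valid : ∀ k ks → Valid (raise [] (k ∷ ks)) × 2 ≤ finalHeight (raise [] (k ∷ ks))
raise-tall-valid k []        = last (s≤s z≤n) , s≤s (s≤s z≤n)
raise-tall-valid k (k′ ∷ ks) = let v , 2≤h = raise-tall-valid k′ ks in s≤s (s≤s z≤n) ∷ v , 2≤h

raise-short-valid : ∀ ks → Valid (raise (1 ∷ []) ks) × finalHeight (raise (1 ∷ []) ks) ≡ 1
raise-short-valid []            = last (s≤s z≤n) , refl
raise-short-valid (k ∷ [])      = s≤s (s≤s z≤n) ∷ last (s≤s z≤n) , refl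
raise-short-valid (k ∷ k′ ∷ ks) = let v , h≡1 = raise-short-valid (k′ ∷ ks) in s≤s (s≤s z≤n) ∷ v , h≡1

valid-raise : ∀ {hs} → Valid hs → (∃ λ k → ∃ λ ks → hs ≡ raise [] (k ∷ ks)) ⊎ (∃ λ ks → hs ≡ raise (1 ∷ []) ks)
valid-raise (last {suc zero}    _) = inj₂ ([] , refl)
valid-raise (last {suc (suc k)} _) = inj₁ (k , [] , refl)
valid-raise (_∷_ {suc (suc k)} _ v) with valid-raise v
... | inj₁ (k′ , ks , refl) = inj₁ (k , k′ ∷ ks , refl)
... | inj₂ (ks , refl)      = inj₂ (k ∷ ks , refl)
valid-raise (_∷_ {suc zero} (s≤s ()) _)

-- The start value 1 makes the first increment (1 + k₁ − 1)⁺ equal to k₁.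
tallHeights : ℕ → ℕ → List (List ℕ)
tallHeights m N = map (raise []) (climbs (suc m) 1 N)

-- A single column of height 1 has vertical semiperimeter 1, hence no list when m = 0.
shortHeights : ℕ → ℕ → List (List ℕ)
shortHeights zero    N = []
shortHeights (suc m) N = map (raise (1 ∷ [])) (climbs (suc m) 1 N)

HasSize : ℕ → ℕ → List ℕ → Set
HasSize m N hs = length hs ≡ suc m × rise 0 hs ≡ suc (suc N)

tallHeights-sound : ∀ m N {hs} → hs ∈ tallHeights m N → Valid hs × HasSize m N hs × 2 ≤ finalHeight hs
tallHeights-sound m N hs∈ with ∈-map⁻ (raise []) hs∈
... | []     , ks∈ , refl with () ← proj₁ (∈-climbs⁻ (suc m) 1 N ks∈)
... | k ∷ ks , ks∈ , refl =
  let v , 2≤h = raise-tall-valid k ks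
      len , eq = ∈-climbs⁻ (suc m) 1 N ks∈
  in v , (trans (length-raise [] (k ∷ ks)) (trans (+-identityʳ _) len) ,
          cong (λ r → suc (suc r)) (trans (cong (λ r → k + r) (rise-raise (λ _ → refl) k ks)) eq)) , 2≤h

tallHeights-complete : ∀ m N {hs} → Valid hs → HasSize m N hs → 2 ≤ finalHeight hs → hs ∈ tallHeights m N
tallHeights-complete m N v (len , eq) 2≤h with valid-raise v
... | inj₂ (ks , refl) = contradiction (proj₂ (raise-short-valid ks)) (<⇒≢ 2≤h ∘ sym)
... | inj₁ (k , ks , refl) = ∈-map⁺ (raise []) (subst₂ (λ a b → k ∷ ks ∈ climbs a 1 b)
  (trans (sym (+-identityʳ _)) (trans (sym (length-raise [] (k ∷ ks))) len))
  (trans (cong (λ r → k + r) (sym (rise-raise (λ _ → refl) k ks))) (suc-injective (suc-injective eq)))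
  (∈-climbs⁺ 1 (k ∷ ks)))

shortHeights-sound : ∀ m N {hs} → hs ∈ shortHeights m N → Valid hs × HasSize m N hs × finalHeight hs ≡ 1
shortHeights-sound (suc m) N hs∈ with ∈-map⁻ (raise (1 ∷ [])) hs∈
... | []     , ks∈ , refl with () ← proj₁ (∈-climbs⁻ (suc m) 1 N ks∈)
... | k ∷ ks , ks∈ , refl =
  let v , h≡1 = raise-short-valid (k ∷ ks)
      len , eq = ∈-climbs⁻ (suc m) 1 N ks∈
  in v , (trans (length-raise (1 ∷ []) (k ∷ ks)) (trans (+-comm (suc (length ks)) 1) (cong suc len)) ,
          cong (λ r → suc (suc r)) (trans (cong (λ r → k + r) (rise-raise short-flat k ks)) eq)) , h≡1

shortHeights-complete : ∀ m N {hs} → Valid hs → HasSize m N hs → finalHeight hs ≡ 1 → hs ∈ shortHeights m N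
shortHeights-complete m N v (len , eq) h≡1 with valid-raise v
... | inj₁ (k , ks , refl) = contradiction h≡1 (<⇒≢ (proj₂ (raise-tall-valid k ks)) ∘ sym)
shortHeights-complete zero N v (len , ()) h≡1 | inj₂ ([] , refl)
shortHeights-complete zero N v (len , eq) h≡1 | inj₂ (k ∷ [] , refl) with () ← len
shortHeights-complete zero N v (len , eq) h≡1 | inj₂ (k ∷ _ ∷ _ , refl) with () ← len
shortHeights-complete (suc m) N v (len , eq) h≡1 | inj₂ (k ∷ ks , refl) =
  ∈-map⁺ (raise (1 ∷ [])) (subst₂ (λ a b → k ∷ ks ∈ climbs a 1 b)
    (suc-injective (trans (+-comm 1 (suc (length ks))) (trans (sym (length-raise (1 ∷ []) (k ∷ ks))) len)))
    (trans (cong (λ r → k + r) (sym (rise-raise short-flat k ks))) (suc-injective (suc-injective eq)))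
    (∈-climbs⁺ 1 (k ∷ ks)))

tallHeights-unique : ∀ m N → Unique (tallHeights m N)
tallHeights-unique m N = Unique.map⁺ (raise-injective []) (climbs-unique (suc m) 1 N)

shortHeights-unique : ∀ m N → Unique (shortHeights m N)
shortHeights-unique zero    N = []
shortHeights-unique (suc m) N = Unique.map⁺ (raise-injective (1 ∷ [])) (climbs-unique (suc m) 1 N)

heights-disjoint : ∀ m N {hs} → hs ∈ tallHeights m N × hs ∈ shortHeights m N → ⊥
heights-disjoint m N (p , q) =
  <⇒≢ (proj₂ (proj₂ (tallHeights-sound m N p))) (sym (proj₂ (proj₂ (shortHeights-sound m N q))))

-- Evaluation of the counts

length-tallHeights : ∀ m N → length (tallHeights m N) ≡ catalan (suc m) * binom N (suc m ⊖ 1)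
length-tallHeights m N = trans (length-map (raise []) (climbs (suc m) 1 N)) (length-climbs-catalan m N)

length-shortHeights : ∀ m N → length (shortHeights m N) ≡ catalan m * binom N (suc m ⊖ 2)
-- The index `1 ⊖ 2` is negative, so `binom` is 0, matching the empty list.
length-shortHeights zero    N = refl
length-shortHeights (suc m) N =
  trans (length-map (raise (1 ∷ [])) (climbs (suc m) 1 N)) (length-climbs-catalan m N)

numberOfHeights : ∀ H m N L → Unique L →
  (∀ {hs} → hs ∈ L → Valid hs × HasSize m N hs × H (finalHeight hs)) →
  (∀ {hs} → Valid hs → HasSize m N hs → H (finalHeight hs) → hs ∈ L) →
  NumberOf (λ P → FibonacciOfSize (suc m) (2 + N) P × LastColumnHeight H P) (length L)
numberOfHeights H m N L unique-L sound complete = numberOf _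
  (λ {P} {P′} P≈ (size , h) →
    FibonacciOfSize-≈ {suc m} {2 + N} {P} {P′} P≈ size , LastColumnHeight-≈ {H} {P} {P′} P≈ h)
  (proj₁ ∘ proj₁) L unique-L
  (λ {hs} hs∈ → let v , size , h = sound hs∈ in
    v , from (FibonacciOfSize-polyomino {suc m} {2 + N} hs v) size , from (LastColumnHeight-polyomino {H} hs v) h)
  (λ {hs} v (size , h) → complete v
    (to (FibonacciOfSize-polyomino {suc m} {2 + N} hs v) size) (to (LastColumnHeight-polyomino {H} hs v) h))

numberOfAll : ∀ m N → NumberOf (FibonacciOfSize (suc m) (2 + N)) (length (tallHeights m N ++ shortHeights m N))
numberOfAll m N = numberOf _ (λ {P} {P′} → FibonacciOfSize-≈ {suc m} {2 + N} {P} {P′}) proj₁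
  (tallHeights m N ++ shortHeights m N)
  (Unique.++⁺ (tallHeights-unique m N) (shortHeights-unique m N) (heights-disjoint m N))
  sound complete
  where
  sound : ∀ {hs} → hs ∈ tallHeights m N ++ shortHeights m N →
          ∃ λ (v : Valid hs) → FibonacciOfSize (suc m) (2 + N) (polyomino hs v)
  sound {hs} hs∈ with ∈-++⁻ (tallHeights m N) hs∈
  ... | inj₁ p = let v , size , _ = tallHeights-sound m N p in v , from (FibonacciOfSize-polyomino {suc m} {2 + N} hs v) size
  ... | inj₂ p = let v , size , _ = shortHeights-sound m N p in v , from (FibonacciOfSize-polyomino {suc m} {2 + N} hs v) size

  complete : ∀ {hs} (v : Valid hs) → FibonacciOfSize (suc m) (2 + N) (polyomino hs v) →
             hs ∈ tallHeights m N ++ shortHeights m N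
  complete {hs} v fib with size ← to (FibonacciOfSize-polyomino {suc m} {2 + N} hs v) fib with valid-raise v
  ... | inj₁ (k , ks , refl) = ∈-++⁺ˡ (tallHeights-complete m N v size (proj₂ (raise-tall-valid k ks)))
  ... | inj₂ (ks , refl) =
    ∈-++⁺ʳ (tallHeights m N) (shortHeights-complete m N v size (proj₂ (raise-short-valid ks)))

length-allHeights : ∀ m N → length (tallHeights m N ++ shortHeights m N)
  ≡ catalan (suc m) * binom N (suc m ⊖ 1) + catalan m * binom N (suc m ⊖ 2)
length-allHeights m N = trans (length-++ (tallHeights m N)) (cong₂ _+_ (length-tallHeights m N) (length-shortHeights m N))

-- For m = n = N + 2 the binomials are (N choose N + 1) = 0 and (N choose N) = 1: only polyominoes
-- ending in a column of height 1 remain.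
diagonal : ∀ N → catalan (2 + N) * binom N (2 + N ⊖ 1) + catalan (suc N) * binom N (2 + N ⊖ 2) ≡ catalan (suc N)
diagonal N = begin
  catalan (2 + N) * (N C suc N) + catalan (suc N) * (N C N)
    ≡⟨ cong₂ (λ a b → catalan (2 + N) * a + catalan (suc N) * b) (k>n⇒nCk≡0 (n<1+n N)) (nCn≡1 N) ⟩
  catalan (2 + N) * 0 + catalan (suc N) * 1
    ≡⟨ cong₂ _+_ (*-zeroʳ (catalan (2 + N))) (*-identityʳ (catalan (suc N))) ⟩
  catalan (suc N) ∎
  where open ≡-Reasoning

theorem3p2 : (∀ (m n : ℕ) → 1 ≤ m → 2 ≤ n →
    NumberOf (FibonacciOfSize m n)
    (catalan m * binom (n ∸ 2) (m ⊖ 1) + catalan (m ∸ 1) * binom (n ∸ 2) (m ⊖ 2))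
    × NumberOf (λ P → FibonacciOfSize m n P × LastColumnHeight (λ h → 2 ≤ h) P)
    (catalan m * binom (n ∸ 2) (m ⊖ 1))
    × NumberOf (λ P → FibonacciOfSize m n P × LastColumnHeight (λ h → h ≡ 1) P)
    (catalan (m ∸ 1) * binom (n ∸ 2) (m ⊖ 2)))
    × (∀ (n : ℕ) → 2 ≤ n → NumberOf (FibonacciOfSize n n) (catalan (n ∸ 1)))
theorem3p2 = counts , onDiagonal
  where
  counts : ∀ m n → 1 ≤ m → 2 ≤ n → _ × _ × _
  counts (suc m) (suc (suc N)) (s≤s _) (s≤s (s≤s _)) =
    subst (NumberOf _) (length-allHeights m N) (numberOfAll m N) ,
    subst (NumberOf _) (length-tallHeights m N)
      (numberOfHeights (2 ≤_) m N _ (tallHeights-unique m N) (tallHeights-sound m N) (tallHeights-complete m N)) ,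
    subst (NumberOf _) (length-shortHeights m N)
      (numberOfHeights (_≡ 1) m N _ (shortHeights-unique m N) (shortHeights-sound m N) (shortHeights-complete m N))

  onDiagonal : ∀ n → 2 ≤ n → NumberOf (FibonacciOfSize n n) (catalan (n ∸ 1))
  onDiagonal (suc (suc N)) (s≤s (s≤s _)) =
    subst (NumberOf _) (trans (length-allHeights (suc N) N) (diagonal N)) (numberOfAll (suc N) N)
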